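{- Let $\mathcal{O}$ be a Dedekind domain. For a co-torsion $\mathcal{O}$-submodule $M\subsetneq \mathcal{O}^2$, the invariant factor ideals $\mathcal{L}\supseteq \mathcal{K}$ of $M$ together with the projective space invariant element $[a:b]\in \mathbb{PF}^1_{\mathcal{I}}$ of $M$, where $\mathcal{K}=\mathcal{L}\mathcal{I}$, completely determine $M$ as a subset of $\mathcal{O}^2$. In other words: if $M_1,M_2\subsetneq \mathcal{O}^2$ are two co-torsion $\mathcal{O}$-submodules with invariant factor ideals $\mathcal{L}_i\supseteq \mathcal{K}_i$ and projective space invariant elements $[a_i:b_i]\in \mathbb{PF}^1_{\mathcal{I}_i}$, where $\mathcal{K}_i=\mathcal{L}_i\mathcal{I}_i$, $i=1,2$, then $$M_1=M_2 \iff \mathcal{L}_1=\mathcal{L}_2,\ \mathcal{K}_1=\mathcal{K}_2 \text{ and } [a_1:b_1]=[a_2:b_2]\in \mathbb{PF}^1_{\mathcal{J}}, \text{ where } \mathcal{J}=\mathcal{I}_1=\mathcal{I}_2.$$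
   Context: An $\mathcal{O}$-submodule $M\subseteq \mathcal{O}^2$ is co-torsion if $\mathcal{O}^2/M$ is a torsion $\mathcal{O}$-module. Projective space: let $(\mathcal{O}^2)^{*}=\{(a,b)\in \mathcal{O}^2\mid \langle a\rangle +\langle b\rangle = \mathcal{O}\}$. For an ideal $\mathcal{I}\subseteq\mathcal{O}$, define the equivalence relation on $(\mathcal{O}^2)^*$ by $(a,b)\sim (c,d)$ iff $ad-bc\in \mathcal{I}$. Then $\mathbb{PF}^1_{\mathcal{I}}=(\mathcal{O}^2)^{*}/\sim$, and the class of $(a,b)$ is denoted $[a:b]$. Invariants of a co-torsion submodule $M\subsetneq\mathcal{O}^2$: there are finitely many distinct maximal ideals $\mathcal{M}_1,\dots,\mathcal{M}_r$ of $\mathcal{O}$ (the elementary maximal ideal divisors) and integers $0\le l_i\le k_i\ne 0$, $1\le i\le r$, with $\mathcal{O}^2/M\cong\bigoplus_{i=1}^r\big(\mathcal{O}/\mathcal{M}_i^{l_i}\oplus\mathcal{O}/\mathcal{M}_i^{k_i}\big)$. The invariant factor ideals are $\mathcal{L}=\prod_{i=1}^r\mathcal{M}_i^{l_i}\supseteq\mathcal{K}=\prod_{i=1}^r\mathcal{M}_i^{k_i}$, so that $\mathcal{O}^2/M\cong\mathcal{O}/\mathcal{L}\oplus\mathcal{O}/\mathcal{K}$. The projective space invariant ideal is $\mathcal{I}=\prod_{i=1}^r\mathcal{M}_i^{k_i-l_i}$, so $\mathcal{K}=\mathcal{L}\mathcal{I}$. The projective space invariant element of $M$ is the class $[a:b]\in\mathbb{PF}^1_{\mathcal{I}}$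 of any $(a,b)\in(\mathcal{O}^2)^*$ for which there is $t\in\mathcal{L}\setminus\bigcup_{i=1}^r\mathcal{L}\mathcal{M}_i$ with $(ta,tb)\in M$; such a pair exists and its class in $\mathbb{PF}^1_{\mathcal{I}}$ depends only on $M$. -}

module Defs where

open import Algebra.Bundles using (CommutativeMonoid; CommutativeRing)
open import Algebra.Module.Bundles using (Module)
import Algebra.Module.Construct.DirectProduct as DirectProduct
import Algebra.Module.Construct.TensorUnit as TensorUnit
open import Algebra.Module.Morphism.Structures using (IsModuleIsomorphism)
open import Algebra.Module.Structures.Biased using (IsModuleFromLeft)
import Algebra.Properties.AbelianGroup as AbelianGroupProperties
import Algebra.Properties.CommutativeSemigroup as CommutativeSemigroupProperties
import Algebra.Properties.Ring as RingProperties
import Algebra.Solver.Ring.NaturalCoefficients.Default as SemiringSolver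
open import Data.Fin.Base using (Fin; zero; suc)
open import Data.List.Base using (List; []; _∷_)
open import Data.Nat.Base as ℕ using (ℕ; zero; suc)
open import Data.Product.Base using (Σ; ∃; _×_; _,_; proj₁; proj₂)
open import Data.Sum.Base using (_⊎_; inj₁; inj₂)
open import Data.Vec.Functional using (Vector)
open import Level using (Level; _⊔_) renaming (suc to lsuc)
open import Relation.Binary.Bundles using (Setoid)
open import Relation.Binary.PropositionalEquality.Core using (_≢_)
import Relation.Binary.Reasoning.Setoid as SetoidReasoning
open import Relation.Nullary.Negation.Core using (¬_)
import Relation.Unary as U

module Theory {c ℓ : Level} (𝒪 : CommutativeRing c ℓ) where

  open CommutativeRing 𝒪 hiding (zero)
  private
    module RP = RingProperties ring

  record Submodule {m ℓm} (X : Module 𝒪 m ℓm) (p : Level)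
                   : Set (c ⊔ m ⊔ ℓm ⊔ lsuc p) where
    open Module X
    field
      Member  : U.Pred Carrierᴹ p
      resp    : ∀ {x y} → x ≈ᴹ y → Member x → Member y
      0-mem   : Member 0ᴹ
      +-mem   : ∀ {x y} → Member x → Member y → Member (x +ᴹ y)
      *ₗ-mem  : ∀ r {x} → Member x → Member (r *ₗ x)

  module _ {m ℓm p : Level} {X : Module 𝒪 m ℓm} where
    open Module X using (Carrierᴹ)

    infix 4 _∈_ _∉_ _⊆_ _≐_

    _∈_ _∉_ : Carrierᴹ → Submodule X p → Set p
    x ∈ N = Submodule.Member N x
    x ∉ N = ¬ (x ∈ N)

    _⊆_ _≐_ : Submodule X p → Submodule X p → Set (m ⊔ p)
    N ⊆ N′ = Submodule.Member N U.⊆ Submodule.Member N′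
    N ≐ N′ = Submodule.Member N U.≐ Submodule.Member N′

    Proper : Submodule X p → Set (m ⊔ p)
    Proper N = ¬ (∀ x → x ∈ N)

  module _ {m ℓm p : Level} (X : Module 𝒪 m ℓm) (N : Submodule X p) where
    private
      open module X = Module X
      open Submodule N
      module AP = AbelianGroupProperties X.+ᴹ-abelianGroup
      open CommutativeSemigroupProperties
        (CommutativeMonoid.commutativeSemigroup X.+ᴹ-commutativeMonoid)
        using (interchange)
      open SetoidReasoning X.≈ᴹ-setoid

      infix 4 _∼_
      _∼_ : Carrierᴹ → Carrierᴹ → Set p
      x ∼ y = Member (x +ᴹ -ᴹ y)

      *ₗ-neg : ∀ r x → r *ₗ (-ᴹ x) ≈ᴹ -ᴹ (r *ₗ x)
      *ₗ-neg r x = AP.inverseʳ-unique (r *ₗ x) (r *ₗ (-ᴹ x)) (begin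
        r *ₗ x +ᴹ r *ₗ (-ᴹ x)  ≈⟨ X.*ₗ-distribˡ r x (-ᴹ x) ⟨
        r *ₗ (x +ᴹ -ᴹ x)       ≈⟨ X.*ₗ-congˡ (X.-ᴹ‿inverseʳ x) ⟩
        r *ₗ 0ᴹ                ≈⟨ X.*ₗ-zeroʳ r ⟩
        0ᴹ                     ∎)

      -1*x : ∀ x → (- 1#) *ₗ x ≈ᴹ -ᴹ x
      -1*x x = AP.inverseʳ-unique x ((- 1#) *ₗ x) (begin
        x +ᴹ (- 1#) *ₗ x         ≈⟨ X.+ᴹ-congʳ (X.*ₗ-identityˡ x) ⟨
        1# *ₗ x +ᴹ (- 1#) *ₗ x   ≈⟨ X.*ₗ-distribʳ x 1# (- 1#) ⟨
        (1# + - 1#) *ₗ x         ≈⟨ X.*ₗ-congʳ (-‿inverseʳ 1#) ⟩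
        0# *ₗ x                  ≈⟨ X.*ₗ-zeroˡ x ⟩
        0ᴹ                       ∎)

      neg-mem : ∀ {x} → Member x → Member (-ᴹ x)
      neg-mem {x} x∈N = resp (-1*x x) (*ₗ-mem (- 1#) x∈N)

      ≈⇒∼ : ∀ {x y} → x ≈ᴹ y → x ∼ y
      ≈⇒∼ x≈y = resp (X.≈ᴹ-sym (AP.x≈y⇒x∙y⁻¹≈ε x≈y)) 0-mem

      ∼-sym : ∀ {x y} → x ∼ y → y ∼ x
      ∼-sym {x} {y} x∼y = resp (AP.⁻¹-anti-homo‿- x y) (neg-mem x∼y)

      ∼-trans : ∀ {x y z} → x ∼ y → y ∼ z → x ∼ z
      ∼-trans {x} {y} {z} x∼y y∼z = resp (begin
        (x +ᴹ -ᴹ y) +ᴹ (y +ᴹ -ᴹ z)  ≈⟨ X.+ᴹ-assoc x (-ᴹ y) _ ⟩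
        x +ᴹ (-ᴹ y +ᴹ (y +ᴹ -ᴹ z))  ≈⟨ X.+ᴹ-congˡ (X.+ᴹ-assoc (-ᴹ y) y _) ⟨
        x +ᴹ ((-ᴹ y +ᴹ y) +ᴹ -ᴹ z)  ≈⟨ X.+ᴹ-congˡ (X.+ᴹ-congʳ (X.-ᴹ‿inverseˡ y)) ⟩
        x +ᴹ (0ᴹ +ᴹ -ᴹ z)           ≈⟨ X.+ᴹ-congˡ (X.+ᴹ-identityˡ _) ⟩
        x +ᴹ -ᴹ z                   ∎) (+-mem x∼y y∼z)

      ∼-+ : ∀ {x y u v} → x ∼ y → u ∼ v → (x +ᴹ u) ∼ (y +ᴹ v)
      ∼-+ {x} {y} {u} {v} x∼y u∼v = resp (begin
        (x +ᴹ -ᴹ y) +ᴹ (u +ᴹ -ᴹ v)  ≈⟨ interchange x (-ᴹ y) u (-ᴹ v) ⟩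
        (x +ᴹ u) +ᴹ (-ᴹ y +ᴹ -ᴹ v)  ≈⟨ X.+ᴹ-congˡ (AP.⁻¹-∙-comm y v) ⟩
        (x +ᴹ u) +ᴹ -ᴹ (y +ᴹ v)     ∎) (+-mem x∼y u∼v)

      ∼-neg : ∀ {x y} → x ∼ y → (-ᴹ x) ∼ (-ᴹ y)
      ∼-neg {x} {y} x∼y = resp (X.≈ᴹ-sym (AP.⁻¹-∙-comm x (-ᴹ y))) (neg-mem x∼y)

      ∼-* : ∀ {r s x y} → r ≈ s → x ∼ y → (r *ₗ x) ∼ (s *ₗ y)
      ∼-* {r} {s} {x} {y} r≈s x∼y = resp (begin
        r *ₗ (x +ᴹ -ᴹ y)          ≈⟨ X.*ₗ-distribˡ r x (-ᴹ y) ⟩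
        r *ₗ x +ᴹ r *ₗ (-ᴹ y)     ≈⟨ X.+ᴹ-congˡ (X.*ₗ-congʳ r≈s) ⟩
        r *ₗ x +ᴹ s *ₗ (-ᴹ y)     ≈⟨ X.+ᴹ-congˡ (*ₗ-neg s y) ⟩
        r *ₗ x +ᴹ -ᴹ (s *ₗ y)     ∎) (*ₗ-mem r x∼y)

    infixl 7 _/_

    _/_ : Module 𝒪 m p
    _/_ = record
      { Carrierᴹ = Carrierᴹ
      ; _≈ᴹ_ = λ x y → (x +ᴹ -ᴹ y) ∈ N
      ; _+ᴹ_ = _+ᴹ_
      ; _*ₗ_ = _*ₗ_
      ; _*ᵣ_ = λ x r → r *ₗ x
      ; 0ᴹ = 0ᴹ
      ; -ᴹ_ = -ᴹ_
      ; isModule = IsModuleFromLeft.isModule {commutativeRing = 𝒪} record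
        { isLeftModule = record
          { isLeftSemimodule = record
            { +ᴹ-isCommutativeMonoid = record
              { isMonoid = record
                { isSemigroup = record
                  { isMagma = record
                    { isEquivalence = record
                      { refl = ≈⇒∼ X.≈ᴹ-refl ; sym = ∼-sym ; trans = ∼-trans }
                    ; ∙-cong = ∼-+
                    }
                  ; assoc = λ x y z → ≈⇒∼ (X.+ᴹ-assoc x y z)
                  }
                ; identity = (λ x → ≈⇒∼ (X.+ᴹ-identityˡ x))
                           , (λ x → ≈⇒∼ (X.+ᴹ-identityʳ x))
                }
              ; comm = λ x y → ≈⇒∼ (X.+ᴹ-comm x y)
              }
            ; isPreleftSemimodule = record
              { *ₗ-cong = ∼-*
              ; *ₗ-zeroˡ = λ x → ≈⇒∼ (X.*ₗ-zeroˡ x)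
              ; *ₗ-distribʳ = λ x r s → ≈⇒∼ (X.*ₗ-distribʳ x r s)
              ; *ₗ-identityˡ = λ x → ≈⇒∼ (X.*ₗ-identityˡ x)
              ; *ₗ-assoc = λ r s x → ≈⇒∼ (X.*ₗ-assoc r s x)
              ; *ₗ-zeroʳ = λ r → ≈⇒∼ (X.*ₗ-zeroʳ r)
              ; *ₗ-distribˡ = λ r x y → ≈⇒∼ (X.*ₗ-distribˡ r x y)
              }
            }
          ; -ᴹ‿cong = ∼-neg
          ; -ᴹ‿inverse = (λ x → ≈⇒∼ (X.-ᴹ‿inverseˡ x))
                       , (λ x → ≈⇒∼ (X.-ᴹ‿inverseʳ x))
          }
        }
      }

  infixr 6 _⊕_

  _⊕_ : ∀ {m ℓm m′ ℓm′} → Module 𝒪 m ℓm → Module 𝒪 m′ ℓm′ →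
        Module 𝒪 (m ⊔ m′) (ℓm ⊔ ℓm′)
  X ⊕ Y = DirectProduct.⟨module⟩ X Y

  ⨁ : ∀ {m ℓm n} → (Fin n → Module 𝒪 m ℓm) → Module 𝒪 m ℓm
  ⨁ {n = n} F = record
    { Carrierᴹ = (i : Fin n) → X.Carrierᴹ i
    ; _≈ᴹ_ = λ x y → ∀ i → X._≈ᴹ_ i (x i) (y i)
    ; _+ᴹ_ = λ x y i → X._+ᴹ_ i (x i) (y i)
    ; _*ₗ_ = λ r x i → X._*ₗ_ i r (x i)
    ; _*ᵣ_ = λ x r i → X._*ₗ_ i r (x i)
    ; 0ᴹ = λ i → X.0ᴹ i
    ; -ᴹ_ = λ x i → X.-ᴹ_ i (x i)
    ; isModule = IsModuleFromLeft.isModule {commutativeRing = 𝒪} record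
      { isLeftModule = record
        { isLeftSemimodule = record
          { +ᴹ-isCommutativeMonoid = record
            { isMonoid = record
              { isSemigroup = record
                { isMagma = record
                  { isEquivalence = record
                    { refl = λ i → X.≈ᴹ-refl i
                    ; sym = λ e i → X.≈ᴹ-sym i (e i)
                    ; trans = λ e f i → X.≈ᴹ-trans i (e i) (f i)
                    }
                  ; ∙-cong = λ e f i → X.+ᴹ-cong i (e i) (f i)
                  }
                ; assoc = λ x y z i → X.+ᴹ-assoc i (x i) (y i) (z i)
                }
              ; identity = (λ x i → X.+ᴹ-identityˡ i (x i))
                         , (λ x i → X.+ᴹ-identityʳ i (x i))
              }
            ; comm = λ x y i → X.+ᴹ-comm i (x i) (y i)
            }
          ; isPreleftSemimodule = record
            { *ₗ-cong = λ e f i → X.*ₗ-cong i e (f i)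
            ; *ₗ-zeroˡ = λ x i → X.*ₗ-zeroˡ i (x i)
            ; *ₗ-distribʳ = λ x r s i → X.*ₗ-distribʳ i (x i) r s
            ; *ₗ-identityˡ = λ x i → X.*ₗ-identityˡ i (x i)
            ; *ₗ-assoc = λ r s x i → X.*ₗ-assoc i r s (x i)
            ; *ₗ-zeroʳ = λ r i → X.*ₗ-zeroʳ i r
            ; *ₗ-distribˡ = λ r x y i → X.*ₗ-distribˡ i r (x i) (y i)
            }
          }
        ; -ᴹ‿cong = λ e i → X.-ᴹ‿cong i (e i)
        ; -ᴹ‿inverse = (λ x i → X.-ᴹ‿inverseˡ i (x i))
                     , (λ x i → X.-ᴹ‿inverseʳ i (x i))
        }
      }
    } where module X (i : Fin n) = Module (F i)

  infix 4 _≅_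

  _≅_ : ∀ {m ℓm m′ ℓm′} → Module 𝒪 m ℓm → Module 𝒪 m′ ℓm′ →
        Set (c ⊔ m ⊔ ℓm ⊔ m′ ⊔ ℓm′)
  X ≅ Y = Σ (Module.Carrierᴹ X → Module.Carrierᴹ Y)
            (IsModuleIsomorphism (Module.rawModule X) (Module.rawModule Y))

  IsTorsion : ∀ {m ℓm} → Module 𝒪 m ℓm → Set (c ⊔ ℓ ⊔ m ⊔ ℓm)
  IsTorsion X = ∀ x → ∃ λ r → r ≉ 0# × r *ₗ x ≈ᴹ 0ᴹ
    where open Module X

  𝒪¹ : Module 𝒪 c ℓ
  𝒪¹ = TensorUnit.⟨module⟩

  Ideal : Set (lsuc (c ⊔ ℓ))
  Ideal = Submodule 𝒪¹ (c ⊔ ℓ)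

  ⟨_⟩ : Carrier → Ideal
  ⟨ a ⟩ = record
    { Member = λ x → ∃ λ r → x ≈ r * a
    ; resp   = λ { x≈y (r , x≈ra) → r , trans (sym x≈y) x≈ra }
    ; 0-mem  = 0# , sym (zeroˡ a)
    ; +-mem  = λ { (r , x≈ra) (s , y≈sa) →
                   r + s , trans (+-cong x≈ra y≈sa) (sym (distribʳ a r s)) }
    ; *ₗ-mem = λ { t (r , x≈ra) →
                   t * r , trans (*-congˡ x≈ra) (sym (*-assoc t r a)) }
    }

  infixl 6 _+ᴵ_
  infixl 7 _·_
  infixr 8 _^_

  _+ᴵ_ : Ideal → Ideal → Ideal
  I +ᴵ J = record
    { Member = λ x → ∃ λ a → ∃ λ b → a ∈ I × b ∈ J × x ≈ a + b
    ; resp   = λ { x≈y (a , b , a∈I , b∈J , x≈a+b) →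
                   a , b , a∈I , b∈J , trans (sym x≈y) x≈a+b }
    ; 0-mem  = 0# , 0# , I.0-mem , J.0-mem , sym (+-identityˡ 0#)
    ; +-mem  = λ { (a , b , a∈I , b∈J , x≈a+b) (a′ , b′ , a′∈I , b′∈J , y≈a′+b′) →
                   a + a′ , b + b′ , I.+-mem a∈I a′∈I , J.+-mem b∈J b′∈J ,
                   trans (+-cong x≈a+b y≈a′+b′) (interchange a b a′ b′) }
    ; *ₗ-mem = λ { r (a , b , a∈I , b∈J , x≈a+b) →
                   r * a , r * b , I.*ₗ-mem r a∈I , J.*ₗ-mem r b∈J ,
                   trans (*-congˡ x≈a+b) (distribˡ r a b) }
    }
    where
    module I = Submodule I
    module J = Submodule J
    open CommutativeSemigroupProperties +-commutativeSemigroup using (interchange)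

  -- Finite sums of products a * b with a ∈ I and b ∈ J.
  data SumOfProducts (I J : Ideal) : Carrier → Set (c ⊔ ℓ) where
    product : ∀ {a b} → a ∈ I → b ∈ J → SumOfProducts I J (a * b)
    empty   : SumOfProducts I J 0#
    plus    : ∀ {x y} → SumOfProducts I J x → SumOfProducts I J y →
              SumOfProducts I J (x + y)
    equal   : ∀ {x y} → x ≈ y → SumOfProducts I J x → SumOfProducts I J y

  _·_ : Ideal → Ideal → Ideal
  I · J = record
    { Member = SumOfProducts I J
    ; resp   = equal
    ; 0-mem  = empty
    ; +-mem  = plus
    ; *ₗ-mem = scale
    }
    where
    scale : ∀ r {x} → SumOfProducts I J x → SumOfProducts I J (r * x)
    scale r (product {a} {b} a∈I b∈J) =
      equal (*-assoc r a b) (product (Submodule.*ₗ-mem I r a∈I) b∈J)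
    scale r empty = equal (sym (zeroʳ r)) empty
    scale r (plus {x} {y} p q) =
      equal (sym (distribˡ r x y)) (plus (scale r p) (scale r q))
    scale r (equal x≈y p) = equal (*-congˡ x≈y) (scale r p)

  _^_ : Ideal → ℕ → Ideal
  I ^ zero  = ⟨ 1# ⟩
  I ^ suc n = I · (I ^ n)

  ∏ : ∀ {n} → (Fin n → Ideal) → Ideal
  ∏ {zero}  F = ⟨ 1# ⟩
  ∏ {suc n} F = F zero · ∏ (λ i → F (suc i))

  span : ∀ {n} → Vector Carrier n → Ideal
  span {zero}  g = ⟨ 0# ⟩
  span {suc n} g = ⟨ g zero ⟩ +ᴵ span (λ i → g (suc i))

  IsNonzero : Ideal → Set (c ⊔ ℓ)
  IsNonzero I = ∃ λ x → x ∈ I × x ≉ 0#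

  record IsPrime (P : Ideal) : Set (c ⊔ ℓ) where
    field
      proper : Proper P
      prime  : ∀ {x y} → (x * y) ∈ P → x ∈ P ⊎ y ∈ P

  record IsMaximal (P : Ideal) : Set (lsuc (c ⊔ ℓ)) where
    field
      proper  : Proper P
      maximal : ∀ (J : Ideal) → P ⊆ J → J ⊆ P ⊎ (∀ x → x ∈ J)

  record IsIntegralDomain : Set (c ⊔ ℓ) where
    field
      1≉0            : 1# ≉ 0#
      noZeroDivisors : ∀ {x y} → x * y ≈ 0# → x ≈ 0# ⊎ y ≈ 0#

  module FieldOfFractions (isIntegralDomain : IsIntegralDomain) where
    open IsIntegralDomain isIntegralDomain

    record Fraction : Set (c ⊔ ℓ) where
      constructor frac
      field
        num   : Carrier
        den   : Carrier
        den≉0 : den ≉ 0#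

    open Fraction public

    private
      *-≉0 : ∀ {x y} → x ≉ 0# → y ≉ 0# → x * y ≉ 0#
      *-≉0 x≉0 y≉0 xy≈0 with noZeroDivisors xy≈0
      ... | inj₁ x≈0 = x≉0 x≈0
      ... | inj₂ y≈0 = y≉0 y≈0

    infix  4 _≃_
    infixl 6 _+ᶠ_
    infixl 7 _*ᶠ_

    _≃_ : Fraction → Fraction → Set ℓ
    x ≃ y = num x * den y ≈ num y * den x

    _+ᶠ_ _*ᶠ_ : Fraction → Fraction → Fraction
    x +ᶠ y = frac (num x * den y + num y * den x) (den x * den y)
                  (*-≉0 (den≉0 x) (den≉0 y))
    x *ᶠ y = frac (num x * num y) (den x * den y) (*-≉0 (den≉0 x) (den≉0 y))

    ι : Carrier → Fraction
    ι a = frac a 1# 1≉0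

    -- The monic polynomial c₀ + c₁ X + ⋯ + cₙ₋₁ Xⁿ⁻¹ + Xⁿ, given by the list
    -- of its non-leading coefficients c₀ , … , cₙ₋₁, evaluated by Horner's rule.
    evalMonic : List Carrier → Fraction → Fraction
    evalMonic []       x = ι 1#
    evalMonic (a ∷ as) x = ι a +ᶠ x *ᶠ evalMonic as x

    IsIntegral : Fraction → Set (c ⊔ ℓ)
    IsIntegral x = ∃ λ as → evalMonic as x ≃ ι 0#

  IsIntegrallyClosed : IsIntegralDomain → Set (c ⊔ ℓ)
  IsIntegrallyClosed d = ∀ x → IsIntegral x → ∃ λ a → x ≃ ι a
    where open FieldOfFractions d

  IsNoetherian : Set (lsuc (c ⊔ ℓ))
  IsNoetherian = ∀ (I : Ideal) → ∃ λ n → Σ (Vector Carrier n) λ g → I ≐ span g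

  -- Fields are admitted; they have no proper co-torsion submodule of 𝒪².
  record IsDedekindDomain : Set (lsuc (c ⊔ ℓ)) where
    field
      isIntegralDomain     : IsIntegralDomain
      isNoetherian         : IsNoetherian
      isIntegrallyClosed   : IsIntegrallyClosed isIntegralDomain
      nonzeroPrime⇒maximal : ∀ P → IsNonzero P → IsPrime P → IsMaximal P

  record UnimodularPair : Set (c ⊔ ℓ) where
    constructor mkPair
    field
      fst snd    : Carrier
      unimodular : ⟨ fst ⟩ +ᴵ ⟨ snd ⟩ ≐ ⟨ 1# ⟩

  open UnimodularPair public

  PF¹ : Ideal → Setoid (c ⊔ ℓ) (c ⊔ ℓ)
  PF¹ I = record
    { Carrier = UnimodularPair
    ; _≈_ = _∼_
    ; isEquivalence = record
      { refl  = λ {p} → I.resp (sym (trans (+-congˡ (-‿cong (*-comm (snd p) (fst p))))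
                                           (-‿inverseʳ _))) I.0-mem
      ; sym   = λ {p} {q} → ∼-sym p q
      ; trans = λ {p} {q} {s} → ∼-trans p q s
      }
    }
    where
    module I = Submodule I
    open SetoidReasoning setoid
    open SemiringSolver commutativeSemiring

    infix 4 _∼_
    _∼_ : UnimodularPair → UnimodularPair → Set (c ⊔ ℓ)
    p ∼ q = (fst p * snd q - snd p * fst q) ∈ I

    ∼-sym : ∀ p q → p ∼ q → q ∼ p
    ∼-sym p q p∼q = I.resp (begin
      - 1# * (fst p * snd q - snd p * fst q)    ≈⟨ RP.-1*x≈-x _ ⟩
      - (fst p * snd q - snd p * fst q)         ≈⟨ RP.⁻¹-anti-homo-// _ _ ⟩
      snd p * fst q - fst p * snd q             ≈⟨ +-cong (*-comm _ _) (-‿cong (*-comm _ _)) ⟩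
      fst q * snd p - snd q * fst p             ∎) (I.*ₗ-mem (- 1#) p∼q)

    sub : ∀ x y → x + - 1# * y ≈ x - y
    sub x y = +-congˡ (RP.-1*x≈-x y)

    -- p = (a , b), q = (k , d), s = (e , f) and 1 = x k + y d; then
    -- a f - b e = (x e + y f) (a d - b k) + (x a + y b) (k f - d e).
    identity : ∀ a b k d e f x y →
      (x * e + y * f) * (a * d - b * k) + (x * a + y * b) * (k * f - d * e)
        ≈ (x * k + y * d) * (a * f - b * e)
    identity a b k d e f x y = begin
      (x * e + y * f) * (a * d - b * k) + (x * a + y * b) * (k * f - d * e)
        ≈⟨ +-cong (*-congˡ (sym (sub _ _))) (*-congˡ (sym (sub _ _))) ⟩
      (x * e + y * f) * (a * d + - 1# * (b * k)) + (x * a + y * b) * (k * f + - 1# * (d * e))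
        ≈⟨ solve 9 (λ a b k d e f x y n →
             (x :* e :+ y :* f) :* (a :* d :+ n :* (b :* k))
               :+ (x :* a :+ y :* b) :* (k :* f :+ n :* (d :* e))
             := (x :* k :+ y :* d) :* (a :* f :+ n :* (b :* e))
               :+ (con 1 :+ n) :* (x :* e :* a :* d :+ y :* f :* b :* k))
             refl a b k d e f x y (- 1#) ⟩
      (x * k + y * d) * (a * f + - 1# * (b * e)) + (1# + - 1#) * (x * e * a * d + y * f * b * k)
        ≈⟨ +-cong (*-congˡ (sub _ _)) (*-congʳ (-‿inverseʳ 1#)) ⟩
      (x * k + y * d) * (a * f - b * e) + 0# * (x * e * a * d + y * f * b * k)
        ≈⟨ trans (+-congˡ (zeroˡ _)) (+-identityʳ _) ⟩
      (x * k + y * d) * (a * f - b * e) ∎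

    ∼-trans : ∀ p q s → p ∼ q → q ∼ s → p ∼ s
    ∼-trans p q s p∼q q∼s
      with proj₂ (unimodular q) (1# , sym (*-identityˡ 1#))
    ... | u , v , (x , u≈xk) , (y , v≈yd) , 1≈u+v = I.resp (begin
      _ ≈⟨ identity (fst p) (snd p) (fst q) (snd q) (fst s) (snd s) x y ⟩
      (x * fst q + y * snd q) * (fst p * snd s - snd p * fst s)
        ≈⟨ *-congʳ (trans 1≈u+v (+-cong u≈xk v≈yd)) ⟨
      1# * (fst p * snd s - snd p * fst s)
        ≈⟨ *-identityˡ _ ⟩
      fst p * snd s - snd p * fst s ∎)
      (I.+-mem (I.*ₗ-mem _ p∼q) (I.*ₗ-mem _ q∼s))

  𝒪² : Module 𝒪 c ℓ
  𝒪² = 𝒪¹ ⊕ 𝒪¹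

  IsCoTorsion : Submodule 𝒪² (c ⊔ ℓ) → Set (c ⊔ ℓ)
  IsCoTorsion M = IsTorsion (𝒪² / M)

  record InvariantDecomposition (M : Submodule 𝒪² (c ⊔ ℓ)) : Set (lsuc (c ⊔ ℓ)) where
    field
      r          : ℕ
      𝓜          : Fin r → Ideal
      𝓜-maximal  : ∀ i → IsMaximal (𝓜 i)
      𝓜-distinct : ∀ {i j} → i ≢ j → ¬ (𝓜 i ≐ 𝓜 j)
      l k        : Fin r → ℕ
      l≤k        : ∀ i → l i ℕ.≤ k i
      k≢0        : ∀ i → k i ≢ 0
      iso        : 𝒪² / M ≅ ⨁ (λ i → (𝒪¹ / 𝓜 i ^ l i) ⊕ (𝒪¹ / 𝓜 i ^ k i))

    𝓛 𝓚 𝓘 : Ideal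
    𝓛 = ∏ (λ i → 𝓜 i ^ l i)
    𝓚 = ∏ (λ i → 𝓜 i ^ k i)
    𝓘 = ∏ (λ i → 𝓜 i ^ (k i ℕ.∸ l i))

    IsAdapted : UnimodularPair → Set (c ⊔ ℓ)
    IsAdapted p = ∃ λ t → t ∈ 𝓛 × (∀ i → t ∉ 𝓛 · 𝓜 i) × (t * fst p , t * snd p) ∈ M

    -- The class of p in PF¹ 𝓘 is the invariant element of M.
    IsProjectiveInvariant : Setoid.Carrier (PF¹ 𝓘) → Set (c ⊔ ℓ)
    IsProjectiveInvariant p = ∃ λ q → IsAdapted q × Setoid._≈_ (PF¹ 𝓘) p q

  open InvariantDecomposition public
    using (𝓛; 𝓚; 𝓘; IsAdapted; IsProjectiveInvariant)

{-# OPTIONS --safe #-}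

-- M = 𝓛 p + 𝓚 𝒪² = { v ∈ 𝓛 𝒪² : det (v , p) ∈ 𝓚 } for every adapted pair p, so M can be read
-- off from 𝓛, 𝓚 and p, and only the class of p modulo 𝓘 matters since 𝓛 𝓘 = 𝓚.  Conversely
-- 𝓚 is the annihilator of 𝒪² / M, 𝓛 is generated by the entries of the vectors of M, and if p
-- and q are both adapted to M, then det (s p , q) ∈ 𝓚 for all s ∈ 𝓛, so det (p , q) ∈ (𝓚 : 𝓛) = 𝓘.
--
-- To describe M, let (α , β) : 𝒪² → 𝒪 / P ^ l ⊕ 𝒪 / P ^ k be a component of the isomorphism.  If
-- t ∈ P ^ l is not in P ^ (l + 1) and t p ∈ M, then t β(p) ∈ P ^ k gives β(p) ∈ P ^ (k - l).  As β
-- takes the value 1 modulo P ^ k at some w, the Plücker relation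
--   det (v , p) β(w) + det (p , w) β(v) + det (w , v) β(p) = 0
-- shows that det (v , p) ∈ P ^ k for v ∈ M.
--
-- Both (𝓚 : 𝓛) = 𝓘 and the step from t β(p) to β(p) use a local uniformizer of P, that is, π ∈ P
-- and τ ∉ P with τ P ⊆ (π).  Pick 0 ≠ a ∈ P; an ideal ((a) : b) ⊆ P that is maximal among those
-- is a nonzero prime, hence equal to P.  If (b / a) P ⊆ P, then b / a would be integral, so
-- b ∈ (a) and P = 𝒪; hence b π = a τ for some π ∈ P and τ ∉ P.
module Submission where

open import Defs
open import Algebra.Bundles using (CommutativeRing)
open import Algebra.Module.Bundles using (Module)
open import Algebra.Module.Morphism.Structures using (module IsModuleIsomorphism)
open import Algebra.Solver.Ring.AlmostCommutativeRing
  using (fromCommutativeRing; _-Raw-AlmostCommutative⟶_)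
import Algebra.Properties.CommutativeSemigroup as CommutativeSemigroupProperties
import Algebra.Properties.Ring as RingProperties
import Algebra.Properties.Semiring.Exp as Exponentiation
import Algebra.Properties.Semiring.Mult.TCOptimised as Multiple
open import Axiom.ExcludedMiddle using (ExcludedMiddle)
open import Data.Empty using (⊥-elim)
import Data.Fin.Base as Fin
open import Data.Fin.Base using (Fin)
import Data.Fin.Properties as Fin
import Data.Integer.Base as ℤ
import Data.Integer.Properties as ℤ
open import Data.List.Base using (List; []; _∷_)
open import Data.Maybe.Base using (Maybe; just; nothing)
import Data.Nat.Base as ℕ
open import Data.Nat.Base using (ℕ)
import Data.Nat.Properties as ℕ
open import Data.Product.Base using (Σ; ∃; _×_; _,_; proj₁; proj₂)
import Data.Sign.Base as Sign
open import Data.Sum.Base using (_⊎_; inj₁; inj₂)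
open import Data.Vec.Functional using (Vector)
open import Function.Base using (_∘_)
open import Function.Bundles using (_⇔_; mk⇔)
open import Level using (Level; _⊔_; Lift; lift; lower)
open import Relation.Binary.Bundles using (Setoid)
open import Relation.Binary.PropositionalEquality.Core as ≡ using (_≡_; _≢_)
import Relation.Binary.Reasoning.Setoid as SetoidReasoning
open import Relation.Nullary.Decidable.Core using (Dec; yes; no; map′; decidable-stable)
open import Relation.Nullary.Negation.Core using (¬_; contradiction)

-- With the library's natural coefficients the ring solver cannot cancel x - x.
module IntegerCoefficients {c ℓ : Level} (R : CommutativeRing c ℓ) where
  open CommutativeRing R
  open RingProperties ring
  open Multiple semiring using (1+×; ×-homo-+; ×1-homo-*) renaming (_×_ to _×ᴺ_)
  open SetoidReasoning setoid

  private
    fromℤ : ℤ.ℤ → Carrier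
    fromℤ (ℤ.+ n)      = n ×ᴺ 1#
    fromℤ (ℤ.-[1+ n ]) = - (ℕ.suc n ×ᴺ 1#)

    signed : Sign.Sign → Carrier → Carrier
    signed Sign.+ x = x
    signed Sign.- x = - x

    signed-* : ∀ s t x y → signed (s Sign.* t) (x * y) ≈ signed s x * signed t y
    signed-* Sign.+ Sign.+ x y = refl
    signed-* Sign.+ Sign.- x y = -‿distribʳ-* x y
    signed-* Sign.- Sign.+ x y = -‿distribˡ-* x y
    signed-* Sign.- Sign.- x y = begin
      x * y         ≈⟨ -‿involutive (x * y) ⟨
      - - (x * y)   ≈⟨ -‿cong (-‿distribˡ-* x y) ⟩
      - (- x * y)   ≈⟨ -‿distribʳ-* (- x) y ⟩
      - x * - y     ∎

    signed-cong : ∀ s {x y} → x ≈ y → signed s x ≈ signed s y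
    signed-cong Sign.+ x≈y = x≈y
    signed-cong Sign.- x≈y = -‿cong x≈y

    fromℤ-◃ : ∀ s n → fromℤ (s ℤ.◃ n) ≈ signed s (n ×ᴺ 1#)
    fromℤ-◃ Sign.+ ℕ.zero    = refl
    fromℤ-◃ Sign.- ℕ.zero    = sym -0#≈0#
    fromℤ-◃ Sign.+ (ℕ.suc n) = refl
    fromℤ-◃ Sign.- (ℕ.suc n) = refl

    fromℤ-signed : ∀ i → fromℤ i ≡ signed (ℤ.sign i) (ℤ.∣ i ∣ ×ᴺ 1#)
    fromℤ-signed (ℤ.+ n)      = ≡.refl
    fromℤ-signed (ℤ.-[1+ n ]) = ≡.refl

    fromℤ-* : ∀ i j → fromℤ (i ℤ.* j) ≈ fromℤ i * fromℤ j
    fromℤ-* i j = begin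
      fromℤ (s Sign.* t ℤ.◃ m ℕ.* n)             ≈⟨ fromℤ-◃ (s Sign.* t) (m ℕ.* n) ⟩
      signed (s Sign.* t) ((m ℕ.* n) ×ᴺ 1#)      ≈⟨ signed-cong (s Sign.* t) (×1-homo-* m n) ⟩
      signed (s Sign.* t) ((m ×ᴺ 1#) * (n ×ᴺ 1#)) ≈⟨ signed-* s t (m ×ᴺ 1#) (n ×ᴺ 1#) ⟩
      signed s (m ×ᴺ 1#) * signed t (n ×ᴺ 1#)     ≡⟨ ≡.cong₂ _*_ (fromℤ-signed i) (fromℤ-signed j) ⟨
      fromℤ i * fromℤ j                          ∎
      where s = ℤ.sign i ; t = ℤ.sign j ; m = ℤ.∣ i ∣ ; n = ℤ.∣ j ∣

    x-0≈x : ∀ x → x - 0# ≈ x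
    x-0≈x x = trans (+-congˡ -0#≈0#) (+-identityʳ x)

    cancel-1+ : ∀ x y → (1# + x) - (1# + y) ≈ x - y
    cancel-1+ x y = begin
      (1# + x) - (1# + y)     ≈⟨ +-congʳ (+-comm 1# x) ⟩
      (x + 1#) - (1# + y)     ≈⟨ +-congˡ (-‿anti-homo-+ 1# y) ⟩
      (x + 1#) + (- y - 1#)   ≈⟨ +-congˡ (+-comm (- y) (- 1#)) ⟩
      (x + 1#) + (- 1# - y)   ≈⟨ +-assoc x 1# _ ⟩
      x + (1# + (- 1# - y))   ≈⟨ +-congˡ (\\-leftDividesˡ 1# (- y)) ⟩
      x - y                   ∎

    fromℤ-⊖ : ∀ m n → fromℤ (m ℤ.⊖ n) ≈ m ×ᴺ 1# - n ×ᴺ 1#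
    fromℤ-⊖ m          ℕ.zero    = sym (x-0≈x _)
    fromℤ-⊖ ℕ.zero    (ℕ.suc n) = sym (+-identityˡ _)
    fromℤ-⊖ (ℕ.suc m) (ℕ.suc n) = begin
      fromℤ (ℕ.suc m ℤ.⊖ ℕ.suc n)             ≡⟨ ≡.cong fromℤ (ℤ.[1+m]⊖[1+n]≡m⊖n m n) ⟩
      fromℤ (m ℤ.⊖ n)                         ≈⟨ fromℤ-⊖ m n ⟩
      m ×ᴺ 1# - n ×ᴺ 1#                       ≈⟨ cancel-1+ _ _ ⟨
      (1# + m ×ᴺ 1#) - (1# + n ×ᴺ 1#)         ≈⟨ +-cong (1+× m 1#) (-‿cong (1+× n 1#)) ⟨
      ℕ.suc m ×ᴺ 1# - ℕ.suc n ×ᴺ 1#           ∎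

    fromℤ-+ : ∀ i j → fromℤ (i ℤ.+ j) ≈ fromℤ i + fromℤ j
    fromℤ-+ (ℤ.+ m)      (ℤ.+ n)      = ×-homo-+ 1# m n
    fromℤ-+ (ℤ.+ m)      (ℤ.-[1+ n ]) = fromℤ-⊖ m (ℕ.suc n)
    fromℤ-+ (ℤ.-[1+ m ]) (ℤ.+ n)      = trans (fromℤ-⊖ n (ℕ.suc m)) (+-comm _ _)
    fromℤ-+ (ℤ.-[1+ m ]) (ℤ.-[1+ n ]) = begin
      - (ℕ.suc (ℕ.suc (m ℕ.+ n)) ×ᴺ 1#)        ≡⟨ ≡.cong (λ k → - (ℕ.suc k ×ᴺ 1#)) (ℕ.+-suc m n) ⟨
      - ((ℕ.suc m ℕ.+ ℕ.suc n) ×ᴺ 1#)          ≈⟨ -‿cong (×-homo-+ 1# (ℕ.suc m) (ℕ.suc n)) ⟩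
      - (ℕ.suc m ×ᴺ 1# + ℕ.suc n ×ᴺ 1#)        ≈⟨ -‿+-comm _ _ ⟨
      - (ℕ.suc m ×ᴺ 1#) - ℕ.suc n ×ᴺ 1#        ∎

    fromℤ-neg : ∀ i → fromℤ (ℤ.- i) ≈ - fromℤ i
    fromℤ-neg (ℤ.+ ℕ.zero)    = sym -0#≈0#
    fromℤ-neg (ℤ.+ (ℕ.suc n)) = refl
    fromℤ-neg (ℤ.-[1+ n ])    = sym (-‿involutive _)

    morphism : ℤ.+-*-rawRing -Raw-AlmostCommutative⟶ fromCommutativeRing R
    morphism = record
      { ⟦_⟧    = fromℤ
      ; +-homo = fromℤ-+
      ; *-homo = fromℤ-*
      ; -‿homo = fromℤ-neg
      ; 0-homo = refl
      ; 1-homo = refl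
      }

    _≟_ : ∀ i j → Maybe (fromℤ i ≈ fromℤ j)
    i ≟ j with i ℤ.≟ j
    ... | yes i≡j = just (reflexive (≡.cong fromℤ i≡j))
    ... | no  _   = nothing

  open import Algebra.Solver.Ring ℤ.+-*-rawRing (fromCommutativeRing R) morphism _≟_ public
    using (solve; _:=_; _:+_; _:*_; _:-_; :-_; con)

-- Ideals of a commutative ring: products, powers and congruences.

module Ideals {c ℓ : Level} (𝒪 : CommutativeRing c ℓ) where
  open CommutativeRing 𝒪
  open Theory 𝒪
  open IntegerCoefficients 𝒪
  open RingProperties ring using (-1*x≈-x)
  open Submodule

  x-0≈x : ∀ x → x - 0# ≈ x
  x-0≈x = solve 1 (λ x → x :- con (ℤ.+ 0) := x) refl

  ∈-neg : ∀ (I : Ideal) {x} → x ∈ I → - x ∈ I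
  ∈-neg I {x} x∈I = resp I (-1*x≈-x x) (*ₗ-mem I (- 1#) x∈I)

  ∈-sub : ∀ (I : Ideal) {x y} → x ∈ I → y ∈ I → x - y ∈ I
  ∈-sub I x∈I y∈I = +-mem I x∈I (∈-neg I y∈I)

  ∈-cancel-+ : ∀ (I : Ideal) {x y} → x - y ∈ I → y ∈ I → x ∈ I
  ∈-cancel-+ I {x} {y} x-y∈I y∈I =
    resp I (solve 2 (λ x y → x :- y :+ y := x) refl x y) (+-mem I x-y∈I y∈I)

  ∈-*ʳ : ∀ (I : Ideal) {x} → x ∈ I → ∀ y → x * y ∈ I
  ∈-*ʳ I {x} x∈I y = resp I (*-comm y x) (*ₗ-mem I y x∈I)

  ∈⟨1⟩ : ∀ x → x ∈ ⟨ 1# ⟩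
  ∈⟨1⟩ x = x , sym (*-identityʳ x)

  1∈⇒∈ : ∀ (I : Ideal) → 1# ∈ I → ∀ x → x ∈ I
  1∈⇒∈ I 1∈I x = resp I (*-identityʳ x) (*ₗ-mem I x 1∈I)

  1∉ : ∀ {I : Ideal} → Proper I → 1# ∉ I
  1∉ {I} I-proper 1∈I = I-proper (1∈⇒∈ I 1∈I)

  ·⊆ˡ : ∀ (I J : Ideal) → (I · J) ⊆ I
  ·⊆ˡ I J (product a∈I _) = ∈-*ʳ I a∈I _
  ·⊆ˡ I J empty           = 0-mem I
  ·⊆ˡ I J (plus p q)      = +-mem I (·⊆ˡ I J p) (·⊆ˡ I J q)
  ·⊆ˡ I J (equal x≈y p)   = resp I x≈y (·⊆ˡ I J p)

  ·⊆ʳ : ∀ (I J : Ideal) → (I · J) ⊆ J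
  ·⊆ʳ I J (product _ b∈J) = *ₗ-mem J _ b∈J
  ·⊆ʳ I J empty           = 0-mem J
  ·⊆ʳ I J (plus p q)      = +-mem J (·⊆ʳ I J p) (·⊆ʳ I J q)
  ·⊆ʳ I J (equal x≈y p)   = resp J x≈y (·⊆ʳ I J p)

  *-∈-· : ∀ (I J K : Ideal) x → (∀ {a b} → a ∈ I → b ∈ J → x * (a * b) ∈ K) →
          ∀ {y} → y ∈ I · J → x * y ∈ K
  *-∈-· I J K x f (product a∈I b∈J) = f a∈I b∈J
  *-∈-· I J K x f empty             = resp K (sym (zeroʳ x)) (0-mem K)
  *-∈-· I J K x f (plus p q)        =
    resp K (sym (distribˡ x _ _)) (+-mem K (*-∈-· I J K x f p) (*-∈-· I J K x f q))
  *-∈-· I J K x f (equal y≈z p)     = resp K (*-congˡ y≈z) (*-∈-· I J K x f p)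

  -- Powers

  ^-suc⊆ : ∀ (P : Ideal) n → (P ^ ℕ.suc n) ⊆ (P ^ n)
  ^-suc⊆ P n = ·⊆ʳ P (P ^ n)

  ^-antitone : ∀ (P : Ideal) {m n} → m ℕ.≤ n → (P ^ n) ⊆ (P ^ m)
  ^-antitone P ℕ.z≤n       _ = ∈⟨1⟩ _
  ^-antitone P {ℕ.suc m} {ℕ.suc n} (ℕ.s≤s m≤n) = go
    where
    go : (P ^ ℕ.suc n) ⊆ (P ^ ℕ.suc m)
    go (product a∈P b∈Pⁿ) = product a∈P (^-antitone P m≤n b∈Pⁿ)
    go empty              = empty
    go (plus p q)         = plus (go p) (go q)
    go (equal x≈y p)      = equal x≈y (go p)

  ^⊆ : ∀ (P : Ideal) {n} → n ≢ 0 → (P ^ n) ⊆ P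
  ^⊆ P {ℕ.zero}  n≢0 = contradiction ≡.refl n≢0
  ^⊆ P {ℕ.suc n} n≢0 = ·⊆ˡ P (P ^ n)

  ∈-^-+ : ∀ (P : Ideal) m n {x y} → x ∈ P ^ m → y ∈ P ^ n → x * y ∈ P ^ (m ℕ.+ n)
  ∈-^-+ P ℕ.zero    n _ y∈Pⁿ = *ₗ-mem (P ^ n) _ y∈Pⁿ
  ∈-^-+ P (ℕ.suc m) n {x} {y} x∈Pᵐ y∈Pⁿ =
    resp R (*-comm y x) (*-∈-· P (P ^ m) R y step x∈Pᵐ)
    where
    R = P ^ (ℕ.suc m ℕ.+ n)
    step : ∀ {a b} → a ∈ P → b ∈ P ^ m → y * (a * b) ∈ R
    step {a} {b} a∈P b∈Pᵐ =
      resp R (solve 3 (λ a b y → a :* (b :* y) := y :* (a :* b)) refl a b y)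
             (product a∈P (∈-^-+ P m n b∈Pᵐ y∈Pⁿ))

  -- Units modulo an ideal

  -- Invertibility of the class of `x` in the quotient by `I`, with `y` representing the inverse.
  UnitMod : Ideal → Carrier → Set (c ⊔ ℓ)
  UnitMod I x = ∃ λ y → 1# - y * x ∈ I

  unitMod-cancel : ∀ (I : Ideal) {x y} → UnitMod I x → x * y ∈ I → y ∈ I
  unitMod-cancel I {x} {y} (z , 1-zx∈I) xy∈I =
    resp I (solve 3 (λ x y z → y :* (con (ℤ.+ 1) :- z :* x) :+ z :* (x :* y) := y) refl x y z)
           (+-mem I (*ₗ-mem I y 1-zx∈I) (*ₗ-mem I z xy∈I))

  -- `(1 - y x)(1 - z x)` again has the form `1 - w x`, so an inverse modulo `P` lifts to every
  -- power of `P`.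
  unitMod-· : ∀ (I J : Ideal) {x} → UnitMod I x → UnitMod J x → UnitMod (I · J) x
  unitMod-· I J {x} (y , p) (z , q) =
    y + z - y * z * x ,
    equal (solve 3 (λ x y z → (con (ℤ.+ 1) :- y :* x) :* (con (ℤ.+ 1) :- z :* x)
                              := con (ℤ.+ 1) :- (y :+ z :- y :* z :* x) :* x) refl x y z)
          (product p q)

  -- Since `x ∉ P`, maximality makes `P +ᴵ ⟨ x ⟩` the whole ring; the part of 1 in `⟨ x ⟩` supplies
  -- the inverse.
  unitMod-maximal : ∀ {P : Ideal} → IsMaximal P → ∀ {x} → x ∉ P → UnitMod P x
  unitMod-maximal {P} P-max {x} x∉P with IsMaximal.maximal P-max (P +ᴵ ⟨ x ⟩) P⊆
    where
    P⊆ : P ⊆ (P +ᴵ ⟨ x ⟩)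
    P⊆ {p} p∈P = p , 0# , p∈P , 0-mem ⟨ x ⟩ , sym (+-identityʳ p)
  ... | inj₁ ⊆P  = contradiction
    (⊆P (0# , x , 0-mem P , (1# , sym (*-identityˡ x)) , sym (+-identityˡ x))) x∉P
  ... | inj₂ all with all 1#
  ...   | p , q , p∈P , (y , q≈yx) , 1≈p+q = y , resp P p≈1-yx p∈P
    where
    open SetoidReasoning setoid
    p≈1-yx : p ≈ 1# - y * x
    p≈1-yx = begin
      p              ≈⟨ solve 2 (λ p q → p := p :+ q :- q) refl p q ⟩
      p + q - q      ≈⟨ +-cong (sym 1≈p+q) (-‿cong q≈yx) ⟩
      1# - y * x     ∎

  unitMod-^ : ∀ {P : Ideal} → IsMaximal P → ∀ {x} → x ∉ P → ∀ n → UnitMod (P ^ n) x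
  unitMod-^     P-max x∉P ℕ.zero    = 0# , ∈⟨1⟩ _
  unitMod-^ {P} P-max x∉P (ℕ.suc n) =
    unitMod-· P (P ^ n) (unitMod-maximal P-max x∉P) (unitMod-^ P-max x∉P n)

  ^-primary : ∀ {P : Ideal} → IsMaximal P → ∀ n {x y} → x ∉ P → x * y ∈ P ^ n → y ∈ P ^ n
  ^-primary {P} P-max n x∉P = unitMod-cancel (P ^ n) (unitMod-^ P-max x∉P n)

  maximal-prime : ∀ {P : Ideal} → IsMaximal P → ∀ {x y} → x ∉ P → x * y ∈ P → y ∈ P
  maximal-prime {P} P-max x∉P = unitMod-cancel P (unitMod-maximal P-max x∉P)

  -- The Chinese remainder theorem

  -- The witness `e` is 1 modulo `I` and 0 modulo `J`, the form in which interpolation uses it.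
  Coprime : Ideal → Ideal → Set (c ⊔ ℓ)
  Coprime I J = ∃ λ e → e ∈ J × 1# - e ∈ I

  coprime-∏ : ∀ (I : Ideal) {n} (F : Fin n → Ideal) → (∀ i → Coprime I (F i)) → Coprime I (∏ F)
  coprime-∏ I {ℕ.zero}  F I-F =
    1# , ∈⟨1⟩ 1# , resp I (sym (-‿inverseʳ 1#)) (0-mem I)
  coprime-∏ I {ℕ.suc n} F I-F with I-F Fin.zero | coprime-∏ I (F ∘ Fin.suc) (I-F ∘ Fin.suc)
  ... | e , e∈ , 1-e∈ | d , d∈ , 1-d∈ =
    e * d , product e∈ d∈ ,
    resp I (solve 2 (λ e d → (con (ℤ.+ 1) :- e) :+ e :* (con (ℤ.+ 1) :- d) := con (ℤ.+ 1) :- e :* d)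
                  refl e d)
           (+-mem I 1-e∈ (*ₗ-mem I e 1-d∈))

  ∏⊆ : ∀ {n} (F : Fin n → Ideal) i → ∏ F ⊆ F i
  ∏⊆ F Fin.zero    x∈∏ = ·⊆ˡ (F Fin.zero) _ x∈∏
  ∏⊆ F (Fin.suc i) x∈∏ = ∏⊆ (F ∘ Fin.suc) i (·⊆ʳ (F Fin.zero) _ x∈∏)

  PairwiseCoprime : ∀ {n} → (Fin n → Ideal) → Set (c ⊔ ℓ)
  PairwiseCoprime F = ∀ i j → i ≢ j → Coprime (F i) (F j)

  private
    tail-coprime : ∀ {n} (F : Fin (ℕ.suc n) → Ideal) → PairwiseCoprime F →
                   PairwiseCoprime (F ∘ Fin.suc)
    tail-coprime F F-coprime i j i≢j = F-coprime (Fin.suc i) (Fin.suc j) (i≢j ∘ Fin.suc-injective)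

    head-coprime : ∀ {n} (F : Fin (ℕ.suc n) → Ideal) → PairwiseCoprime F →
                   Coprime (F Fin.zero) (∏ (F ∘ Fin.suc))
    head-coprime F F-coprime =
      coprime-∏ (F Fin.zero) (F ∘ Fin.suc) (λ i → F-coprime Fin.zero (Fin.suc i) λ ())

  abstract
    -- With `e` in the product of the remaining ideals and `1 - e` in the first, both summands of
    -- `x = (1 - e) x + x e` are products of an element of the first ideal and one of the rest.
    ⋂⊆∏ : ∀ {n} (F : Fin n → Ideal) → PairwiseCoprime F → ∀ {x} → (∀ i → x ∈ F i) → x ∈ ∏ F
    ⋂⊆∏ {ℕ.zero}  F F-coprime     x∈F = ∈⟨1⟩ _
    ⋂⊆∏ {ℕ.suc n} F F-coprime {x} x∈F with head-coprime F F-coprime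
    ... | e , e∈ , 1-e∈ =
      equal (solve 2 (λ e x → (con (ℤ.+ 1) :- e) :* x :+ x :* e := x) refl e x)
        (plus (product 1-e∈ (⋂⊆∏ (F ∘ Fin.suc) (tail-coprime F F-coprime) (x∈F ∘ Fin.suc)))
              (product (x∈F Fin.zero) e∈))

  abstract
    crt : ∀ {n} (F : Fin n → Ideal) → PairwiseCoprime F →
          (q : Fin n → Carrier) → ∃ λ x → ∀ i → x - q i ∈ F i
    crt {ℕ.zero}  F F-coprime q = 0# , λ ()
    crt {ℕ.suc n} F F-coprime q
      with head-coprime F F-coprime | crt (F ∘ Fin.suc) (tail-coprime F F-coprime) (q ∘ Fin.suc)
    -- Here `e` is 1 modulo the first ideal and 0 modulo all others, so it switches between `q₀` and
    -- `y`.
    ... | e , e∈ , 1-e∈ | y , y-q∈ = q₀ * e + y * (1# - e) , λ where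
        Fin.zero → resp (F Fin.zero)
          (solve 3 (λ q e y → (y :- q) :* (con (ℤ.+ 1) :- e) := q :* e :+ y :* (con (ℤ.+ 1) :- e) :- q)
                 refl q₀ e y)
          (*ₗ-mem (F Fin.zero) _ 1-e∈)
        (Fin.suc i) → resp (F (Fin.suc i))
          (solve 4 (λ q e y p → (q :- y) :* e :+ (y :- p) := q :* e :+ y :* (con (ℤ.+ 1) :- e) :- p)
                 refl q₀ e y (q (Fin.suc i)))
          (+-mem (F (Fin.suc i)) (*ₗ-mem (F (Fin.suc i)) _ (∏⊆ (F ∘ Fin.suc) i e∈)) (y-q∈ i))
      where
      q₀ : Carrier
      q₀ = q Fin.zero

-- Dedekind domains: from the axioms to local uniformizers.

module Dedekind {c ℓ : Level} (em : ExcludedMiddle (Level.suc (c ⊔ ℓ))) (𝒪 : CommutativeRing c ℓ)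
                (dedekind : Theory.IsDedekindDomain 𝒪) where
  open CommutativeRing 𝒪
  open Theory 𝒪
  open IsDedekindDomain dedekind
  open IsIntegralDomain isIntegralDomain
  open IntegerCoefficients 𝒪
  open Ideals 𝒪
  open Submodule
  open Exponentiation semiring using () renaming (_^_ to _**_)
  open CommutativeSemigroupProperties *-commutativeSemigroup using (interchange; x∙yz≈y∙xz)
  open RingProperties ring using (x∙y⁻¹≈ε⇒x≈y; x≈y⇒x∙y⁻¹≈ε)

  decide : (A : Set (c ⊔ ℓ)) → Dec A
  decide A = map′ lower lift (em {Lift (Level.suc (c ⊔ ℓ)) A})

  *-cancelˡ : ∀ {a x y} → a ≉ 0# → a * x ≈ a * y → x ≈ y
  *-cancelˡ {a} {x} {y} a≉0 ax≈ay
    with noZeroDivisors (trans (solve 3 (λ a x y → a :* (x :- y) := a :* x :- a :* y) refl a x y)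
                               (x≈y⇒x∙y⁻¹≈ε ax≈ay))
  ... | inj₁ a≈0   = contradiction a≈0 a≉0
  ... | inj₂ x-y≈0 = x∙y⁻¹≈ε⇒x≈y x y x-y≈0

  ⊈-witness : ∀ {I J : Ideal} → ¬ (I ⊆ J) → ∃ λ x → x ∈ I × x ∉ J
  ⊈-witness {I} {J} I⊈J = decidable-stable (decide _) λ none → I⊈J λ {x} x∈I →
    decidable-stable (decide (x ∈ J)) λ x∉J → none (x , x∈I , x∉J)

  maximal-⊈ : ∀ {P Q : Ideal} → IsMaximal P → IsMaximal Q → ¬ (P ≐ Q) → ¬ (P ⊆ Q)
  maximal-⊈ {P} {Q} P-max Q-max P≢Q P⊆Q with IsMaximal.maximal P-max Q P⊆Q
  ... | inj₁ Q⊆P = P≢Q (P⊆Q , Q⊆P)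
  ... | inj₂ all = IsMaximal.proper Q-max all

  abstract
    -- Take `x` in `P` but not in `Q`. Some `1 - y x` lies in `Q ^ n`; it is outside `P` because
    -- `x ∈ P`, hence invertible modulo `P ^ m`, and its multiple by that inverse is the witness.
    coprime-^ : ∀ {P Q : Ideal} → IsMaximal P → IsMaximal Q → ¬ (P ≐ Q) →
                ∀ m n → Coprime (P ^ m) (Q ^ n)
    coprime-^ {P} {Q} P-max Q-max P≢Q m n with ⊈-witness {P} {Q} (maximal-⊈ P-max Q-max P≢Q)
    ... | x , x∈P , x∉Q with unitMod-^ Q-max x∉Q n
    ...   | y , f∈Qⁿ with unitMod-^ P-max f∉P m
      where
      f∉P : 1# - y * x ∉ P
      f∉P f∈P = 1∉ {P} (IsMaximal.proper P-max) (∈-cancel-+ P f∈P (*ₗ-mem P y x∈P))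
    ...     | z , 1-zf∈Pᵐ = z * (1# - y * x) , *ₗ-mem (Q ^ n) z f∈Qⁿ , 1-zf∈Pᵐ

  -- Ascending chains

  ∈-span : ∀ {n} (g : Vector Carrier n) i → g i ∈ span g
  ∈-span g Fin.zero    =
    g Fin.zero , 0# , (1# , sym (*-identityˡ _)) , 0-mem (span (g ∘ Fin.suc)) , sym (+-identityʳ _)
  ∈-span g (Fin.suc i) =
    0# , g (Fin.suc i) , 0-mem ⟨ g Fin.zero ⟩ , ∈-span (g ∘ Fin.suc) i , sym (+-identityˡ _)

  span⊆ : ∀ {n} (g : Vector Carrier n) (I : Ideal) → (∀ i → g i ∈ I) → span g ⊆ I
  span⊆ {ℕ.zero}  g I g∈I (r , x≈r0) = resp I (sym (trans x≈r0 (zeroʳ r))) (0-mem I)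
  span⊆ {ℕ.suc n} g I g∈I (a , b , (r , a≈rg) , b∈span , x≈a+b) = resp I (sym x≈a+b)
    (+-mem I (resp I (sym a≈rg) (*ₗ-mem I r (g∈I Fin.zero)))
             (span⊆ (g ∘ Fin.suc) I (g∈I ∘ Fin.suc) b∈span))

  abstract
    -- The union of the chain is finitely generated, and a stage containing the generators contains
    -- every other stage.
    chain-stabilises : (F : ℕ → Ideal) → (∀ n → F n ⊆ F (ℕ.suc n)) → ∃ λ N → ∀ n → F n ⊆ F N
    chain-stabilises F F-mono = stabilise (isNoetherian ⋃F)
      where
      ≤-mono : ∀ {m n} → m ℕ.≤′ n → F m ⊆ F n
      ≤-mono ℕ.≤′-refl           x∈ = x∈
      ≤-mono (ℕ.≤′-step {n} m≤n) x∈ = F-mono n (≤-mono m≤n x∈)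

      ⋃F : Ideal
      ⋃F = record
        { Member = λ x → ∃ λ n → x ∈ F n
        ; resp   = λ { x≈y (n , x∈) → n , resp (F n) x≈y x∈ }
        ; 0-mem  = 0 , 0-mem (F 0)
        ; +-mem  = λ { (m , x∈) (n , y∈) → m ℕ.⊔ n ,
            +-mem (F (m ℕ.⊔ n)) (≤-mono (ℕ.≤⇒≤′ (ℕ.m≤m⊔n m n)) x∈)
                                (≤-mono (ℕ.≤⇒≤′ (ℕ.m≤n⊔m m n)) y∈) }
        ; *ₗ-mem = λ { r (n , x∈) → n , *ₗ-mem (F n) r x∈ }
        }

      common-bound : ∀ {n} (g : Vector Carrier n) → (∀ i → g i ∈ ⋃F) → ∃ λ N → ∀ i → g i ∈ F N
      common-bound {ℕ.zero}  g g∈ = 0 , λ ()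
      common-bound {ℕ.suc n} g g∈ with g∈ Fin.zero | common-bound (g ∘ Fin.suc) (g∈ ∘ Fin.suc)
      ... | m , g₀∈ | N , gᵢ∈ = m ℕ.⊔ N , λ where
        Fin.zero    → ≤-mono (ℕ.≤⇒≤′ (ℕ.m≤m⊔n m N)) g₀∈
        (Fin.suc i) → ≤-mono (ℕ.≤⇒≤′ (ℕ.m≤n⊔m m N)) (gᵢ∈ i)

      stabilise : (∃ λ n → Σ (Vector Carrier n) λ g → ⋃F ≐ span g) → ∃ λ N → ∀ n → F n ⊆ F N
      stabilise (n , g , ⋃F⊆ , ⊆⋃F) with common-bound g (λ i → ⊆⋃F (∈-span g i))
      ... | N , g∈ = N , λ m x∈ → span⊆ g (F N) g∈ (⋃F⊆ (m , x∈))

  -- Associated primes of a principal ideal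

  infix 8 _∶_
  _∶_ : Ideal → Carrier → Ideal
  I ∶ b = record
    { Member = λ x → x * b ∈ I
    ; resp   = λ x≈y → resp I (*-congʳ x≈y)
    ; 0-mem  = resp I (sym (zeroˡ b)) (0-mem I)
    ; +-mem  = λ x∈ y∈ → resp I (sym (distribʳ b _ _)) (+-mem I x∈ y∈)
    ; *ₗ-mem = λ r x∈ → resp I (sym (*-assoc r _ b)) (*ₗ-mem I r x∈)
    }

  ∶-*⊇ : ∀ (I : Ideal) b s → (I ∶ b) ⊆ (I ∶ (b * s))
  ∶-*⊇ I b s {x} xb∈I = resp I (*-assoc x b s) (∈-*ʳ I xb∈I s)

  Improvable : Ideal → Ideal → Carrier → Set (c ⊔ ℓ)
  Improvable I P b = ∃ λ s → (I ∶ (b * s)) ⊆ P × ¬ ((I ∶ (b * s)) ⊆ (I ∶ b))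

  -- Only multiples `b * s` compete. Their colon ideals contain `I ∶ b`, so repeated failure of
  -- maximality produces an ascending chain.
  MaximalColon : Ideal → Ideal → Carrier → Set (c ⊔ ℓ)
  MaximalColon I P b = (I ∶ b) ⊆ P × (∀ s → (I ∶ (b * s)) ⊆ P → (I ∶ (b * s)) ⊆ (I ∶ b))

  -- Iterating `improve` from 1 gives multipliers whose colon ideals ascend strictly inside `P`,
  -- against stabilisation of chains.
  not-always-improvable : ∀ (I P : Ideal) → I ⊆ P → ¬ (∀ b → (I ∶ b) ⊆ P → Improvable I P b)
  not-always-improvable I P I⊆P improve =
    let N , F⊆F_N = chain-stabilises F (λ n → ∶-*⊇ I (b n) (proj₁ (improve (b n) (b≤P n)))) in
    proj₂ (proj₂ (improve (b N) (b≤P N))) (F⊆F_N (ℕ.suc N))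
    where
    b   : ℕ → Carrier
    b≤P : ∀ n → (I ∶ b n) ⊆ P
    b ℕ.zero      = 1#
    b (ℕ.suc n)   = b n * proj₁ (improve (b n) (b≤P n))
    b≤P ℕ.zero    x∈ = I⊆P (resp I (*-identityʳ _) x∈)
    b≤P (ℕ.suc n) = proj₁ (proj₂ (improve (b n) (b≤P n)))

    F : ℕ → Ideal
    F n = I ∶ b n

  abstract
    maximal-colon : ∀ (I P : Ideal) → I ⊆ P → ∃ (MaximalColon I P)
    maximal-colon I P I⊆P = decidable-stable (decide (∃ (MaximalColon I P))) λ none →
      not-always-improvable I P I⊆P λ b b≤P →
        decidable-stable (decide (Improvable I P b)) λ stuck →
          none (b , b≤P , λ s bs≤P {x} x∈ → decidable-stable (decide (x ∈ I ∶ b)) λ x∉ →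
            stuck (s , bs≤P , λ bs≤b → x∉ (bs≤b x∈)))

  -- Let `x y` be in the colon ideal. If `I ∶ (b * x)` lies in `P`, maximality for the multiplier
  -- `x` puts `y` in the colon ideal. If not, some `s ∉ P` has `s b x ∈ I`; then `I ∶ (b * s)` stays
  -- inside the prime `P`, and maximality for `s` puts `x` in the colon ideal.
  maximalColon-prime : ∀ (I : Ideal) {P : Ideal} b → IsMaximal P → MaximalColon I P b →
                       IsPrime (I ∶ b)
  maximalColon-prime I {P} b P-max (Q⊆P , Q-greatest) = record
    { proper = λ all → IsMaximal.proper P-max (λ x → Q⊆P (all x))
    ; prime  = λ {x} {y} xy∈Q → prime′ xy∈Q (decide (x ∈ I ∶ b)) (decide ((I ∶ (b * x)) ⊆ P))
    }
    where
    x∈Q-if : ∀ x {s} → s ∈ I ∶ (b * x) → s ∉ P → x ∈ I ∶ b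
    x∈Q-if x {s} s∈ s∉P = Q-greatest s
      (λ {r} r∈ → maximal-prime P-max s∉P (Q⊆P
        (resp I (solve 3 (λ r s b → r :* (b :* s) := s :* r :* b) refl r s b) r∈)))
      (resp I (solve 3 (λ x s b → s :* (b :* x) := x :* (b :* s)) refl x s b) s∈)

    prime′ : ∀ {x y} → x * y ∈ I ∶ b → Dec (x ∈ I ∶ b) → Dec ((I ∶ (b * x)) ⊆ P) →
             x ∈ I ∶ b ⊎ y ∈ I ∶ b
    prime′         xy∈Q (yes x∈Q) _ = inj₁ x∈Q
    prime′ {x} {y} xy∈Q (no  x∉Q) (yes bx≤P) = inj₂ (Q-greatest x bx≤P
      (resp I (solve 3 (λ x y b → x :* y :* b := y :* (b :* x)) refl x y b) xy∈Q))
    prime′ {x} {y} xy∈Q (no  x∉Q) (no bx≰P) =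
      let s , s∈ , s∉P = ⊈-witness {I ∶ (b * x)} {P} bx≰P in contradiction (x∈Q-if x s∈ s∉P) x∉Q

  abstract
    maximal-is-colon : ∀ {P : Ideal} → IsMaximal P → ∀ {a} → a ∈ P → a ≉ 0# →
                       ∃ λ b → (⟨ a ⟩ ∶ b) ≐ P
    maximal-is-colon {P} P-max {a} a∈P a≉0 = go
      (maximal-colon ⟨ a ⟩ P (λ { (r , x≈ra) → resp P (sym x≈ra) (*ₗ-mem P r a∈P) }))
      where
      go : ∃ (MaximalColon ⟨ a ⟩ P) → ∃ λ b → (⟨ a ⟩ ∶ b) ≐ P
      go (b , colon) = b , proj₁ colon , P⊆Q
        where
        P⊆Q : P ⊆ (⟨ a ⟩ ∶ b)
        P⊆Q with IsMaximal.maximal (nonzeroPrime⇒maximal (⟨ a ⟩ ∶ b) (a , (b , *-comm a b) , a≉0)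
                                     (maximalColon-prime ⟨ a ⟩ b P-max colon)) P (proj₁ colon)
        ... | inj₁ ⊆Q  = ⊆Q
        ... | inj₂ all = ⊥-elim (IsMaximal.proper P-max all)

  -- Integrality

  open FieldOfFractions isIntegralDomain

  -- When e n stands for xⁿ d, monic rs j stands for xʲ d times the value at x of the
  -- monic polynomial with non-leading coefficients rs, and Chain n for the ideal
  -- generated by d , … , xⁿ⁻¹ d.
  module _ (e : ℕ → Carrier) where
    monic : List Carrier → ℕ → Carrier
    monic []       j = e j
    monic (r ∷ rs) j = r * e j + monic rs (ℕ.suc j)

    Chain : ℕ → Ideal
    Chain ℕ.zero    = ⟨ 0# ⟩
    Chain (ℕ.suc n) = ⟨ e n ⟩ +ᴵ Chain n

    Chain-mono : ∀ n → Chain n ⊆ Chain (ℕ.suc n)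
    Chain-mono n {x} x∈ = 0# , x , 0-mem ⟨ e n ⟩ , x∈ , sym (+-identityˡ x)

    e∈Chain : ∀ n → e n ∈ Chain (ℕ.suc n)
    e∈Chain n = e n , 0# , (1# , sym (*-identityˡ _)) , 0-mem (Chain n) , sym (+-identityʳ _)

    -- The accumulator rs is the tail of the polynomial, in degrees n and above.
    monic-of-Chain : ∀ n rs {x} → x ∈ Chain n → ∃ λ rs′ → monic rs′ 0 ≈ monic rs n - x
    monic-of-Chain ℕ.zero    rs {x} (r , x≈r0) =
      rs , trans (solve 1 (λ m → m := m :- con (ℤ.+ 0)) refl _)
                 (+-congˡ (-‿cong (sym (trans x≈r0 (zeroʳ r)))))
    monic-of-Chain (ℕ.suc n) rs {x} (a , b , (r , a≈reₙ) , b∈ , x≈a+b)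
      with monic-of-Chain n (- r ∷ rs) b∈
    ... | rs′ , eq = rs′ , (begin
      monic rs′ 0
        ≈⟨ eq ⟩
      (- r * e n + monic rs (ℕ.suc n)) - b
        ≈⟨ solve 4 (λ r e m b → (:- r :* e :+ m) :- b := m :- (r :* e :+ b)) refl r (e n) _ b ⟩
      monic rs (ℕ.suc n) - (r * e n + b)
        ≈⟨ +-congˡ (-‿cong (+-congʳ (sym a≈reₙ))) ⟩
      monic rs (ℕ.suc n) - (a + b)
        ≈⟨ +-congˡ (-‿cong (sym x≈a+b)) ⟩
      monic rs (ℕ.suc n) - x ∎)
      where open SetoidReasoning setoid

    -- Once the chain is stationary at `N`, `e N` is a combination of the earlier terms. Moving
    -- everything to one side gives a relation with leading coefficient 1.
    monic-zero : ∃ λ rs → monic rs 0 ≈ 0#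
    monic-zero with chain-stabilises Chain Chain-mono
    ... | N , ⊆Chain with monic-of-Chain N [] (⊆Chain (ℕ.suc N) (e∈Chain N))
    ...   | rs , eq = rs , trans eq (-‿inverseʳ (e N))

    -- Horner's rule with denominators cleared: by hypothesis, multiplication by the fraction `x`
    -- shifts `e j` to `e (suc j)`.
    evalMonic-monic : ∀ x → (∀ n → num x * e n ≈ den x * e (ℕ.suc n)) → ∀ rs j →
      num (evalMonic rs x) * e j ≈ den (evalMonic rs x) * monic rs j
    evalMonic-monic x x·e []       j = refl
    evalMonic-monic x x·e (r ∷ rs) j = begin
      (r * (a * d) + (b * n) * 1#) * e j
        ≈⟨ solve 6 (λ r a d b n e → (r :* (a :* d) :+ (b :* n) :* con (ℤ.+ 1)) :* e
                                    := a :* d :* (r :* e) :+ n :* (b :* e)) refl r a d b n (e j) ⟩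
      a * d * (r * e j) + n * (b * e j)
        ≈⟨ +-congˡ (*-congˡ (x·e j)) ⟩
      a * d * (r * e j) + n * (a * e (ℕ.suc j))
        ≈⟨ +-congˡ (x∙yz≈y∙xz n a _) ⟩
      a * d * (r * e j) + a * (n * e (ℕ.suc j))
        ≈⟨ +-congˡ (*-congˡ (evalMonic-monic x x·e rs (ℕ.suc j))) ⟩
      a * d * (r * e j) + a * (d * m)
        ≈⟨ solve 5 (λ r a d e m → a :* d :* (r :* e) :+ a :* (d :* m)
                                  := (con (ℤ.+ 1) :* (a :* d)) :* (r :* e :+ m)) refl r a d (e j) m ⟩
      (1# * (a * d)) * (r * e j + m) ∎
      where
      open SetoidReasoning setoid
      a = den x
      b = num x
      d = den (evalMonic rs x)
      n = num (evalMonic rs x)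
      m = monic rs (ℕ.suc j)

  abstract
    -- Stability keeps all `xⁿ d` in `I`, hence in the ring, where the Noetherian condition replaces
    -- the determinant trick. Cancelling `d` from a monic relation among them leaves an integral
    -- equation for `x`.
    stable⇒integral : ∀ x (I : Ideal) {d} → d ∈ I → d ≉ 0# →
      (∀ {p} → p ∈ I → ∃ λ q → q ∈ I × num x * p ≈ den x * q) → ∃ λ y → x ≃ ι y
    stable⇒integral x I {d} d∈I d≉0 stable = integral (monic-zero e)
      where
      sequence : ℕ → Σ Carrier (_∈ I)
      sequence ℕ.zero    = d , d∈I
      sequence (ℕ.suc n) = let q , q∈I , _ = stable (proj₂ (sequence n)) in q , q∈I

      e : ℕ → Carrier
      e n = proj₁ (sequence n)

      x·e : ∀ n → num x * e n ≈ den x * e (ℕ.suc n)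
      x·e n = proj₂ (proj₂ (stable (proj₂ (sequence n))))

      integral : (∃ λ rs → monic e rs 0 ≈ 0#) → ∃ λ y → x ≃ ι y
      integral (rs , monic≈0) with noZeroDivisors (begin
        num (evalMonic rs x) * d              ≈⟨ evalMonic-monic e x x·e rs 0 ⟩
        den (evalMonic rs x) * monic e rs 0   ≈⟨ *-congˡ monic≈0 ⟩
        den (evalMonic rs x) * 0#             ≈⟨ zeroʳ _ ⟩
        0#                                    ∎)
        where open SetoidReasoning setoid
      ... | inj₁ num≈0 = isIntegrallyClosed x
        (rs , trans (*-congʳ num≈0) (trans (zeroˡ 1#) (sym (zeroˡ _))))
      ... | inj₂ d≈0   = contradiction d≈0 d≉0

  -- Local uniformizers

  record Uniformizer (P : Ideal) : Set (c ⊔ ℓ) where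
    field
      π τ       : Carrier
      π∈P       : π ∈ P
      π≉0       : π ≉ 0#
      τ∉P       : τ ∉ P
      principal : ∀ {x} → x ∈ P → ∃ λ y → τ * x ≈ π * y

  -- The pair comes from `b π ≈ a τ`. If `x ∈ P` and `b x ≈ a y`, then `a τ x ≈ b π x ≈ a π y`, and
  -- `a` cancels.
  colon⇒uniformizer : ∀ {P : Ideal} → IsMaximal P → ∀ {a b} → a ∈ P → a ≉ 0# →
                      (⟨ a ⟩ ∶ b) ≐ P → Uniformizer P
  colon⇒uniformizer {P} P-max {a} {b} a∈P a≉0 (⊆P , P⊆) =
    from (decidable-stable (decide Escaping) ¬¬escaping)
    where
    Escaping : Set (c ⊔ ℓ)
    Escaping = ∃ λ p → p ∈ P × ∃ λ q → q ∉ P × b * p ≈ a * q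

    quotient : ∀ {p} → p ∈ P → ∃ λ q → b * p ≈ a * q
    quotient {p} p∈P with P⊆ p∈P
    ... | q , pb≈qa = q , trans (*-comm b p) (trans pb≈qa (*-comm q a))

    b∉⟨a⟩ : b ∉ ⟨ a ⟩
    b∉⟨a⟩ b∈ = 1∉ {P} (IsMaximal.proper P-max) (⊆P (resp ⟨ a ⟩ (sym (*-identityˡ b)) b∈))

    -- Otherwise P is stable under b / a.
    ¬¬escaping : ¬ ¬ Escaping
    ¬¬escaping ¬escaping with stable⇒integral (frac b a a≉0) P a∈P a≉0
        (λ {p} p∈P → let q , bp≈aq = quotient p∈P in
          q , decidable-stable (decide (q ∈ P)) (λ q∉P → ¬escaping (p , p∈P , q , q∉P , bp≈aq)) , bp≈aq)
    ... | y , b1≈ya = b∉⟨a⟩ (y , trans (sym (*-identityʳ b)) b1≈ya)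

    from : Escaping → Uniformizer P
    from (π , π∈P , τ , τ∉P , bπ≈aτ) = record
      { π = π ; τ = τ ; π∈P = π∈P ; τ∉P = τ∉P
      ; π≉0 = λ π≈0 → τ∉P (resp P (sym (*-cancelˡ a≉0 (begin
          a * τ  ≈⟨ bπ≈aτ ⟨
          b * π  ≈⟨ *-congˡ π≈0 ⟩
          b * 0# ≈⟨ zeroʳ b ⟩
          0#     ≈⟨ zeroʳ a ⟨
          a * 0# ∎))) (0-mem P))
      ; principal = λ {x} x∈P → let y , bx≈ay = quotient x∈P in y , *-cancelˡ a≉0 (begin
          a * (τ * x) ≈⟨ *-assoc a τ x ⟨
          a * τ * x   ≈⟨ *-congʳ bπ≈aτ ⟨
          b * π * x   ≈⟨ solve 3 (λ b π x → b :* π :* x := π :* (b :* x)) refl b π x ⟩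
          π * (b * x) ≈⟨ *-congˡ bx≈ay ⟩
          π * (a * y) ≈⟨ solve 3 (λ a π y → π :* (a :* y) := a :* (π :* y)) refl a π y ⟩
          a * (π * y) ∎)
      }
      where open SetoidReasoning setoid

  abstract
    uniformizer : ∀ {P : Ideal} → IsMaximal P → IsNonzero P → Uniformizer P
    uniformizer P-max (a , a∈P , a≉0) =
      colon⇒uniformizer P-max a∈P a≉0 (proj₂ (maximal-is-colon P-max a∈P a≉0))

  -- Cancellation of orders at one maximal ideal.

  module Valuation {P : Ideal} (P-max : IsMaximal P) (P-uniformizer : Uniformizer P) where
    open Uniformizer P-uniformizer
    open SetoidReasoning setoid

    π^∈P^ : ∀ n → π ** n ∈ P ^ n
    π^∈P^ ℕ.zero    = ∈⟨1⟩ _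
    π^∈P^ (ℕ.suc n) = product π∈P (π^∈P^ n)

    principal-^ : ∀ n {x} → x ∈ P ^ n → ∃ λ y → τ ** n * x ≈ π ** n * y
    principal-^ ℕ.zero    {x} _ = x , refl
    principal-^ (ℕ.suc n) = go
      where
      go : ∀ {x} → x ∈ P ^ ℕ.suc n → ∃ λ y → τ ** ℕ.suc n * x ≈ π ** ℕ.suc n * y
      go (product {a} {b} a∈P b∈Pⁿ) =
        let y , τa≈πy = principal a∈P ; z , τb≈πz = principal-^ n b∈Pⁿ in y * z , (begin
          τ * τ ** n * (a * b)     ≈⟨ interchange τ (τ ** n) a b ⟩
          (τ * a) * (τ ** n * b)   ≈⟨ *-cong τa≈πy τb≈πz ⟩
          (π * y) * (π ** n * z)   ≈⟨ interchange π y (π ** n) z ⟩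
          π * π ** n * (y * z)     ∎)
      go empty        = 0# , trans (zeroʳ _) (sym (zeroʳ _))
      go (plus p q)   = let y , eq = go p ; z , eq′ = go q in
        y + z , trans (distribˡ _ _ _) (trans (+-cong eq eq′) (sym (distribˡ _ _ _)))
      go (equal x≈y p) = let z , eq = go p in z , trans (*-congˡ (sym x≈y)) eq

    τ^-cancel : ∀ n m {x} → τ ** m * x ∈ P ^ n → x ∈ P ^ n
    τ^-cancel n ℕ.zero    {x} p = resp (P ^ n) (*-identityˡ x) p
    τ^-cancel n (ℕ.suc m) {x} p = τ^-cancel n m
      (^-primary P-max n τ∉P (resp (P ^ n) (*-assoc τ (τ ** m) x) p))

    -- Multiplying by `τ ** suc n` turns `π * x` into a multiple of `π ** suc n`. One `π` cancels in
    -- the domain, and the powers of `τ` are invertible modulo `P ^ n`.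
    π-cancel : ∀ n {x} → π * x ∈ P ^ ℕ.suc n → x ∈ P ^ n
    π-cancel n {x} πx∈ = let y , eq = principal-^ (ℕ.suc n) πx∈ in
      τ^-cancel n (ℕ.suc n) (resp (P ^ n) (*-cancelˡ π≉0 (begin
        π * (π ** n * y)           ≈⟨ *-assoc π (π ** n) y ⟨
        π * π ** n * y             ≈⟨ eq ⟨
        τ ** ℕ.suc n * (π * x)     ≈⟨ x∙yz≈y∙xz _ π x ⟩
        π * (τ ** ℕ.suc n * x)     ∎)) (∈-*ʳ (P ^ n) (π^∈P^ n) y))

    π^-cancel : ∀ l k {x} → π ** l * x ∈ P ^ k → x ∈ P ^ (k ℕ.∸ l)
    π^-cancel ℕ.zero    k         {x} p = resp (P ^ k) (*-identityˡ x) p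
    -- The truncated exponent is 0 here, so the target is the unit ideal.
    π^-cancel (ℕ.suc l) ℕ.zero    p = ∈⟨1⟩ _
    π^-cancel (ℕ.suc l) (ℕ.suc k) {x} p = π^-cancel l k
      (π-cancel k (resp (P ^ ℕ.suc k) (*-assoc π (π ** l) x) p))

    -- Write `τ ** l * t ≈ π ** l * u`. That `t` has order exactly `l` means `u ∉ P`, so first
    -- `π ** l` and then `u` can be cancelled.
    exact-cancel : ∀ l k {t x} → t ∈ P ^ l → t ∉ P ^ ℕ.suc l → t * x ∈ P ^ k → x ∈ P ^ (k ℕ.∸ l)
    exact-cancel l k {t} {x} t∈Pˡ t∉Pˡ⁺¹ tx∈Pᵏ = ^-primary P-max (k ℕ.∸ l) u∉P
      (π^-cancel l k (resp (P ^ k) (begin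
        τ ** l * (t * x)   ≈⟨ *-assoc _ t x ⟨
        τ ** l * t * x     ≈⟨ *-congʳ τt≈πu ⟩
        π ** l * u * x     ≈⟨ *-assoc _ u x ⟩
        π ** l * (u * x)   ∎) (*ₗ-mem (P ^ k) _ tx∈Pᵏ)))
      where
      u = proj₁ (principal-^ l t∈Pˡ)
      τt≈πu = proj₂ (principal-^ l t∈Pˡ)

      u∉P : u ∉ P
      u∉P u∈P = t∉Pˡ⁺¹ (τ^-cancel (ℕ.suc l) l
        (equal (trans (*-comm u _) (sym τt≈πu)) (product u∈P (π^∈P^ l))))

-- The invariant decomposition in terms of linear functionals.

module Presentations {c ℓ : Level} (𝒪 : CommutativeRing c ℓ) where
  open CommutativeRing 𝒪
  open Theory 𝒪
  open IntegerCoefficients 𝒪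
  open Ideals 𝒪
  open Submodule

  infix 8 ⟪_∣_⟫
  ⟪_∣_⟫ : Carrier × Carrier → Carrier × Carrier → Carrier
  ⟪ (a , b) ∣ (x , y) ⟫ = x * a + y * b

  -- The isomorphism in coordinates. A quotient of 𝒪 has the carrier of 𝒪, so each component lifts
  -- to a linear functional on `𝒪²`, determined modulo its ideal.
  record Presentation (M : Submodule 𝒪² (c ⊔ ℓ)) {r : ℕ} (I J : Fin r → Ideal) : Set (c ⊔ ℓ) where
    field
      α β  : Fin r → Carrier × Carrier
      ∈M⇒  : ∀ {v} → v ∈ M → ∀ i → ⟪ α i ∣ v ⟫ ∈ I i × ⟪ β i ∣ v ⟫ ∈ J i
      ⇒∈M  : ∀ {v} → (∀ i → ⟪ α i ∣ v ⟫ ∈ I i × ⟪ β i ∣ v ⟫ ∈ J i) → v ∈ M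
      onto : (x y : Fin r → Carrier) →
             ∃ λ v → ∀ i → ⟪ α i ∣ v ⟫ - x i ∈ I i × ⟪ β i ∣ v ⟫ - y i ∈ J i

  abstract
    presentation : ∀ (M : Submodule 𝒪² (c ⊔ ℓ)) {r} (I J : Fin r → Ideal) →
      𝒪² / M ≅ ⨁ (λ i → (𝒪¹ / I i) ⊕ (𝒪¹ / J i)) → Presentation M I J
    presentation M {r} I J (φ , φ-iso) = record
      { α = α ; β = β
      ; ∈M⇒ = λ {v} v∈M i → let p , q = φ-∈M v∈M i ; p′ , q′ = φ-linear v i in
          ∈-cancel-neg (I i) p′ p , ∈-cancel-neg (J i) q′ q
      ; ⇒∈M = λ {v} αβ∈ → from-φ λ i → let p , q = αβ∈ i ; p′ , q′ = φ-linear v i in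
          ∈-cancel-+ (I i) p′ p , ∈-cancel-+ (J i) q′ q
      ; onto = λ x y → let v , φz≈ = surjective (λ i → x i , y i) in
          v , λ i → let p , q = φz≈ {v} (Q.≈ᴹ-refl {v}) i ; p′ , q′ = φ-linear v i in
            shift (I i) p′ p , shift (J i) q′ q
      }
      where
      open IsModuleIsomorphism φ-iso
      module Q = Module (𝒪² / M)
      module T = Module (⨁ (λ i → (𝒪¹ / I i) ⊕ (𝒪¹ / J i)))
      module 𝒪² = Module 𝒪²

      e₁ e₂ : Carrier × Carrier
      e₁ = 1# , 0#
      e₂ = 0# , 1#

      α β : Fin r → Carrier × Carrier
      α i = proj₁ (φ e₁ i) , proj₁ (φ e₂ i)
      β i = proj₂ (φ e₁ i) , proj₂ (φ e₂ i)

      ∈-cancel-neg : ∀ (N : Ideal) {x y} → x - y ∈ N → x ∈ N → y ∈ N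
      ∈-cancel-neg N {x} {y} x-y∈ x∈ =
        resp N (solve 2 (λ x y → x :- (x :- y) := y) refl x y) (∈-sub N x∈ x-y∈)

      shift : ∀ (N : Ideal) {x y z} → x - y ∈ N → x - z ∈ N → y - z ∈ N
      shift N {x} {y} {z} p q =
        resp N (solve 3 (λ x y z → (x :- z) :- (x :- y) := y :- z) refl x y z) (∈-sub N q p)

      ≈⇒≈Q : ∀ {v w} → v 𝒪².≈ᴹ w → v Q.≈ᴹ w
      ≈⇒≈Q {v} {w} v≈w = resp M (𝒪².≈ᴹ-sym
        (𝒪².≈ᴹ-trans (𝒪².+ᴹ-congʳ v≈w) (𝒪².-ᴹ‿inverseʳ w))) (0-mem M)

      minus-zero : ∀ v → (v 𝒪².+ᴹ 𝒪².-ᴹ 𝒪².0ᴹ) 𝒪².≈ᴹ v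
      minus-zero (x , y) = x-0≈x x , x-0≈x y

      φ-∈M : ∀ {v} → v ∈ M → ∀ i → proj₁ (φ v i) ∈ I i × proj₂ (φ v i) ∈ J i
      φ-∈M {v} v∈M i =
        let p , q = T.≈ᴹ-trans (⟦⟧-cong (resp M (𝒪².≈ᴹ-sym (minus-zero v)) v∈M)) 0ᴹ-homo i in
        ∈-cancel-+ (I i) p (0-mem (I i)) , ∈-cancel-+ (J i) q (0-mem (J i))

      from-φ : ∀ {v} → (∀ i → proj₁ (φ v i) ∈ I i × proj₂ (φ v i) ∈ J i) → v ∈ M
      from-φ {v} φv∈ = resp M (minus-zero v) (injective {v} {𝒪².0ᴹ} (T.≈ᴹ-trans
        (λ i → ∈-sub (I i) (proj₁ (φv∈ i)) (0-mem (I i)) , ∈-sub (J i) (proj₂ (φv∈ i)) (0-mem (J i)))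
        (T.≈ᴹ-sym 0ᴹ-homo)))

      -- On representatives `φ` is additive only modulo the ideals, so its components and the
      -- functionals built from its values at `e₁` and `e₂` agree only up to `I i` and `J i`.
      φ-linear : ∀ v i → proj₁ (φ v i) - ⟪ α i ∣ v ⟫ ∈ I i × proj₂ (φ v i) - ⟪ β i ∣ v ⟫ ∈ J i
      φ-linear (x , y) = T.≈ᴹ-trans
        (⟦⟧-cong (≈⇒≈Q (solve 2 (λ x y → x := x :* con (ℤ.+ 1) :+ y :* con (ℤ.+ 0)) refl x y ,
                        solve 2 (λ x y → y := x :* con (ℤ.+ 0) :+ y :* con (ℤ.+ 1)) refl x y)))
        (T.≈ᴹ-trans (+ᴹ-homo (x 𝒪².*ₗ e₁) (y 𝒪².*ₗ e₂)) (T.+ᴹ-cong (*ₗ-homo x e₁) (*ₗ-homo y e₂)))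

-- Determinants, functionals and the invariants.

module Invariants {c ℓ : Level} (em : ExcludedMiddle (Level.suc (c ⊔ ℓ))) (𝒪 : CommutativeRing c ℓ)
                  (dedekind : Theory.IsDedekindDomain 𝒪) where
  open CommutativeRing 𝒪
  open Theory 𝒪
  open IntegerCoefficients 𝒪
  open Ideals 𝒪
  open Dedekind em 𝒪 dedekind
  open Presentations 𝒪
  open Submodule
  open RingProperties ring using (⁻¹-anti-homo‿-)

  Bezout : UnimodularPair → Set (c ⊔ ℓ)
  Bezout p = ∃ λ x → ∃ λ y → x * fst p + y * snd p ≈ 1#

  bezout : ∀ p → Bezout p
  bezout p = let _ , _ , (x , u≈xa) , (y , v≈yb) , 1≈u+v = proj₂ (unimodular p) (∈⟨1⟩ 1#) in
    x , y , sym (trans 1≈u+v (+-cong u≈xa v≈yb))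

  coordinates : UnimodularPair → Carrier × Carrier
  coordinates p = fst p , snd p

  det : Carrier × Carrier → Carrier × Carrier → Carrier
  det (x , y) (z , w) = x * w - y * z

  -- If `x a + y b = 1` and `p = (a , b)`, then `v = (x v₁ + y v₂) p + det v p (y , - x)`. This is
  -- `β` applied to that decomposition, before the normalisation.
  unimodular-expand : ∀ x y a b v₁ v₂ β₁ β₂ →
    (x * v₁ + y * v₂) * (a * β₁ + b * β₂) + (y * β₁ - x * β₂) * (v₁ * b - v₂ * a)
      ≈ (x * a + y * b) * (v₁ * β₁ + v₂ * β₂)
  unimodular-expand = solve 8 (λ x y a b v₁ v₂ β₁ β₂ →
    (x :* v₁ :+ y :* v₂) :* (a :* β₁ :+ b :* β₂) :+ (y :* β₁ :- x :* β₂) :* (v₁ :* b :- v₂ :* a)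
      := (x :* a :+ y :* b) :* (v₁ :* β₁ :+ v₂ :* β₂)) refl

  -- Modulo det v p the vector v is a multiple of the unimodular p.
  functional-∈ : ∀ (N : Ideal) p β v →
                 (∀ x y → (x * proj₁ v + y * proj₂ v) * ⟪ β ∣ coordinates p ⟫ ∈ N) →
                 det v (coordinates p) ∈ N → ⟪ β ∣ v ⟫ ∈ N
  functional-∈ N p β v sβp∈N det∈N = let x , y , xa+yb≈1 = bezout p in
    resp N (trans (unimodular-expand x y _ _ _ _ _ _) (trans (*-congʳ xa+yb≈1) (*-identityˡ _)))
      (+-mem N (sβp∈N x y) (*ₗ-mem N _ det∈N))

  -- The Plücker relation with `β(w)` replaced by `β(w) - 1`: when `β(w)` is 1 modulo an ideal, the
  -- first summand lies in it.
  plücker : ∀ v₁ v₂ a b w₁ w₂ β₁ β₂ →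
    - ((v₁ * b - v₂ * a) * (w₁ * β₁ + w₂ * β₂ - 1#) + (a * w₂ - b * w₁) * (v₁ * β₁ + v₂ * β₂)
        + (w₁ * v₂ - w₂ * v₁) * (a * β₁ + b * β₂))
      ≈ v₁ * b - v₂ * a
  plücker = solve 8 (λ v₁ v₂ a b w₁ w₂ β₁ β₂ →
    :- ((v₁ :* b :- v₂ :* a) :* (w₁ :* β₁ :+ w₂ :* β₂ :- con (ℤ.+ 1))
        :+ (a :* w₂ :- b :* w₁) :* (v₁ :* β₁ :+ v₂ :* β₂)
        :+ (w₁ :* v₂ :- w₂ :* v₁) :* (a :* β₁ :+ b :* β₂))
      := v₁ :* b :- v₂ :* a) refl

  -- Modulo `N`, the values at `w` and `w′` show that the matrix with rows `α` and `β` has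
  -- determinant with inverse `det w w′`. Cramer's rule then recovers the entries of `v`.
  invertible-kernel : ∀ (N : Ideal) α β w w′ →
    ⟪ α ∣ w ⟫ - 1# ∈ N → ⟪ β ∣ w ⟫ ∈ N → ⟪ α ∣ w′ ⟫ ∈ N → ⟪ β ∣ w′ ⟫ - 1# ∈ N →
    ∀ v → ⟪ α ∣ v ⟫ ∈ N → ⟪ β ∣ v ⟫ ∈ N → proj₁ v ∈ N × proj₂ v ∈ N
  invertible-kernel N α@(α₁ , α₂) β@(β₁ , β₂) w@(w₁ , w₂) w′@(w₁′ , w₂′)
                    αw≡1 βw≡0 αw′≡0 βw′≡1 (v₁ , v₂) αv≡0 βv≡0 =
    unitMod-cancel N det-unit (resp N
      (solve 6 (λ α₁ α₂ β₁ β₂ v₁ v₂ → β₂ :* (v₁ :* α₁ :+ v₂ :* α₂) :- α₂ :* (v₁ :* β₁ :+ v₂ :* β₂)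
        := (α₁ :* β₂ :- α₂ :* β₁) :* v₁) refl α₁ α₂ β₁ β₂ v₁ v₂)
      (∈-sub N (*ₗ-mem N β₂ αv≡0) (*ₗ-mem N α₂ βv≡0))) ,
    unitMod-cancel N det-unit (resp N
      (solve 6 (λ α₁ α₂ β₁ β₂ v₁ v₂ → α₁ :* (v₁ :* β₁ :+ v₂ :* β₂) :- β₁ :* (v₁ :* α₁ :+ v₂ :* α₂)
        := (α₁ :* β₂ :- α₂ :* β₁) :* v₂) refl α₁ α₂ β₁ β₂ v₁ v₂)
      (∈-sub N (*ₗ-mem N α₁ βv≡0) (*ₗ-mem N β₁ αv≡0)))
    where
    det-unit : UnitMod N (det α β)
    det-unit = det w w′ , resp N
      (solve 8 (λ α₁ α₂ β₁ β₂ w₁ w₂ w₁′ w₂′ →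
        (w₁′ :* α₁ :+ w₂′ :* α₂) :* (w₁ :* β₁ :+ w₂ :* β₂)
          :- ((w₁′ :* β₁ :+ w₂′ :* β₂) :* (w₁ :* α₁ :+ w₂ :* α₂ :- con (ℤ.+ 1))
              :+ (w₁′ :* β₁ :+ w₂′ :* β₂ :- con (ℤ.+ 1)))
          := con (ℤ.+ 1) :- (w₁ :* w₂′ :- w₂ :* w₁′) :* (α₁ :* β₂ :- α₂ :* β₁))
        refl α₁ α₂ β₁ β₂ w₁ w₂ w₁′ w₂′)
      (∈-sub N (*ₗ-mem N ⟪ α ∣ w′ ⟫ βw≡0) (+-mem N (*ₗ-mem N ⟪ β ∣ w′ ⟫ αw≡1) βw′≡1))

  -- One submodule: recovering it from its invariants.

  module _ {M : Submodule 𝒪² (c ⊔ ℓ)} (M-cotorsion : IsCoTorsion M) (D : InvariantDecomposition M) where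
    open InvariantDecomposition D hiding (𝓛; 𝓚; 𝓘; IsAdapted; IsProjectiveInvariant)
    open Presentation (presentation M (λ i → 𝓜 i ^ l i) (λ i → 𝓜 i ^ k i) iso)

    scalar-∈ : ∀ i s v → (s * proj₁ v , s * proj₂ v) ∈ M →
               ⟪ β i ∣ v ⟫ - 1# ∈ 𝓜 i ^ k i → s ∈ 𝓜 i ^ k i
    scalar-∈ i s (v₁ , v₂) sv∈M βv≡1 = resp (𝓜 i ^ k i)
      (solve 5 (λ s v₁ v₂ β₁ β₂ →
        (s :* v₁ :* β₁ :+ s :* v₂ :* β₂) :- s :* (v₁ :* β₁ :+ v₂ :* β₂ :- con (ℤ.+ 1)) := s)
        refl s v₁ v₂ (proj₁ (β i)) (proj₂ (β i)))
      (∈-sub (𝓜 i ^ k i) (proj₂ (∈M⇒ sv∈M i)) (*ₗ-mem (𝓜 i ^ k i) s βv≡1))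

    -- A torsion quotient 𝒪 / 𝓜 i ^ k i with k i ≠ 0 forces 𝓜 i to be nonzero.
    𝓜-nonzero : ∀ i → IsNonzero (𝓜 i)
    𝓜-nonzero i =
      let v , αβv = onto (λ _ → 0#) (λ _ → 1#)
          s , s≉0 , sv-0∈M = M-cotorsion v
          sv∈M = resp M (x-0≈x (s * proj₁ v) , x-0≈x (s * proj₂ v)) sv-0∈M
      in s , ^⊆ (𝓜 i) (k≢0 i) (scalar-∈ i s v sv∈M (proj₂ (αβv i))) , s≉0

    module V i = Valuation (𝓜-maximal i) (uniformizer (𝓜-maximal i) (𝓜-nonzero i))

    𝓜^-coprime : (n : Fin r → ℕ) → PairwiseCoprime (λ i → 𝓜 i ^ n i)
    𝓜^-coprime n i j i≢j = coprime-^ (𝓜-maximal i) (𝓜-maximal j) (𝓜-distinct i≢j) (n i) (n j)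

    ∈∏^⇒ : (n : Fin r → ℕ) → ∀ {x} → x ∈ ∏ (λ i → 𝓜 i ^ n i) → ∀ i → x ∈ 𝓜 i ^ n i
    ∈∏^⇒ n x∈ i = ∏⊆ (λ i → 𝓜 i ^ n i) i x∈

    ⇒∈∏^ : (n : Fin r → ℕ) → ∀ {x} → (∀ i → x ∈ 𝓜 i ^ n i) → x ∈ ∏ (λ i → 𝓜 i ^ n i)
    ⇒∈∏^ n = ⋂⊆∏ (λ i → 𝓜 i ^ n i) (𝓜^-coprime n)

    abstract
      -- The multiplier `u` is invertible at `𝓜 i` and absorbs the conditions at all other primes,
      -- so local elements can be tested inside `𝓛`.
      localise : ∀ i → ∃ λ u → 1# - u ∈ 𝓜 i × (∀ {x} → x ∈ 𝓜 i ^ l i → u * x ∈ 𝓛 D)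
      -- Raising each exponent by one keeps the congruence modulo `𝓜 i` even when `l i` is 0.
      localise i = from (crt (λ j → 𝓜 j ^ ℕ.suc (l j)) (𝓜^-coprime (ℕ.suc ∘ l)) (λ j → δ (j Fin.≟ i)))
        where
        δ : ∀ {j} → Dec (j ≡ i) → Carrier
        δ (yes _) = 1#
        δ (no  _) = 0#

        δ-≡ : ∀ {j} (d : Dec (j ≡ i)) → j ≡ i → δ d ≈ 1#
        δ-≡ (yes _)   _   = refl
        δ-≡ (no  j≢i) j≡i = contradiction j≡i j≢i

        δ-≢ : ∀ {j} (d : Dec (j ≡ i)) → j ≢ i → δ d ≈ 0#
        δ-≢ (yes j≡i) j≢i = contradiction j≡i j≢i
        δ-≢ (no  _)   _   = refl

        from : (∃ λ u → ∀ j → u - δ (j Fin.≟ i) ∈ 𝓜 j ^ ℕ.suc (l j)) →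
               ∃ λ u → 1# - u ∈ 𝓜 i × (∀ {x} → x ∈ 𝓜 i ^ l i → u * x ∈ 𝓛 D)
        from (u , u-δ∈) = u , 1-u∈ , λ x∈ → ⇒∈∏^ l (λ j → local x∈ (j Fin.≟ i))
          where
          1-u∈ : 1# - u ∈ 𝓜 i
          1-u∈ = resp (𝓜 i)
            (trans (⁻¹-anti-homo‿- u (δ (i Fin.≟ i))) (+-congʳ (δ-≡ (i Fin.≟ i) ≡.refl)))
            (∈-neg (𝓜 i) (·⊆ˡ (𝓜 i) (𝓜 i ^ l i) (u-δ∈ i)))

          local : ∀ {x j} → x ∈ 𝓜 i ^ l i → Dec (j ≡ i) → u * x ∈ 𝓜 j ^ l j
          local         x∈ (yes ≡.refl) = *ₗ-mem (𝓜 i ^ l i) u x∈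
          local {x} {j} x∈ (no  j≢i)    = ∈-*ʳ (𝓜 j ^ l j) (^-suc⊆ (𝓜 j) (l j)
            (∈-cancel-+ (𝓜 j ^ ℕ.suc (l j)) (u-δ∈ j)
              (resp (𝓜 j ^ ℕ.suc (l j)) (sym (δ-≢ (j Fin.≟ i) j≢i)) (0-mem (𝓜 j ^ ℕ.suc (l j)))))) x

    1-u∈⇒u∉ : ∀ i {u} → 1# - u ∈ 𝓜 i → u ∉ 𝓜 i
    1-u∈⇒u∉ i 1-u∈ u∈ = 1∉ {𝓜 i} (IsMaximal.proper (𝓜-maximal i)) (∈-cancel-+ (𝓜 i) 1-u∈ u∈)

    -- Split `t = u t + t (1 - u)`. This turns the condition on `t` in an adapted pair into having
    -- order exactly `l i` at each `𝓜 i`.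
    𝓛∩^suc⊆𝓛·𝓜 : ∀ i {t} → t ∈ 𝓛 D → t ∈ 𝓜 i ^ ℕ.suc (l i) → t ∈ 𝓛 D · 𝓜 i
    𝓛∩^suc⊆𝓛·𝓜 i {t} t∈𝓛 t∈^ =
      let u , 1-u∈ , u*∈𝓛 = localise i in
      resp (𝓛 D · 𝓜 i) (solve 2 (λ u t → u :* t :+ t :* (con (ℤ.+ 1) :- u) := t) refl u t)
        (plus (*-∈-· (𝓜 i) (𝓜 i ^ l i) (𝓛 D · 𝓜 i) u
                 (λ {a} {b} a∈ b∈ → equal (solve 3 (λ u a b → u :* b :* a := u :* (a :* b)) refl u a b)
                   (product (u*∈𝓛 b∈) a∈)) t∈^)
              (product t∈𝓛 1-u∈))

    -- Testing with `s = u π ^ l` suffices at each prime: `u` cancels because it is outside `𝓜 i`,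
    -- and `π ^ l` lowers the exponent from `k` to `k ∸ l`.
    𝓚∶𝓛⊆𝓘 : ∀ {x} → (∀ {s} → s ∈ 𝓛 D → s * x ∈ 𝓚 D) → x ∈ 𝓘 D
    𝓚∶𝓛⊆𝓘 {x} 𝓛x⊆𝓚 = ⇒∈∏^ (λ i → k i ℕ.∸ l i) λ i →
      let u , 1-u∈ , u*∈𝓛 = localise i in
      V.π^-cancel i (l i) (k i) (^-primary (𝓜-maximal i) (k i) (1-u∈⇒u∉ i 1-u∈)
        (resp (𝓜 i ^ k i) (*-assoc u _ x) (∈∏^⇒ k (𝓛x⊆𝓚 (u*∈𝓛 (V.π^∈P^ i (l i)))) i)))

    𝓛*𝓘⊆𝓚 : ∀ {s x} → s ∈ 𝓛 D → x ∈ 𝓘 D → s * x ∈ 𝓚 D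
    𝓛*𝓘⊆𝓚 {s} {x} s∈ x∈ = ⇒∈∏^ k λ i → ≡.subst (λ n → s * x ∈ 𝓜 i ^ n) (ℕ.m+[n∸m]≡n (l≤k i))
      (∈-^-+ (𝓜 i) (l i) (k i ℕ.∸ l i) (∈∏^⇒ l s∈ i) (∈∏^⇒ (λ i → k i ℕ.∸ l i) x∈ i))

    𝓚⊆𝓛 : 𝓚 D ⊆ 𝓛 D
    𝓚⊆𝓛 x∈ = ⇒∈∏^ l λ i → ^-antitone (𝓜 i) (l≤k i) (∈∏^⇒ k x∈ i)

    𝓚⇒annihilates : ∀ {x} → x ∈ 𝓚 D → ∀ v → (x * proj₁ v , x * proj₂ v) ∈ M
    𝓚⇒annihilates {x} x∈ (v₁ , v₂) = ⇒∈M λ i →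
      entry (𝓜 i ^ l i) (∈∏^⇒ l (𝓚⊆𝓛 x∈) i) (α i) , entry (𝓜 i ^ k i) (∈∏^⇒ k x∈ i) (β i)
      where
      entry : ∀ (N : Ideal) → x ∈ N → ∀ γ → ⟪ γ ∣ (x * v₁ , x * v₂) ⟫ ∈ N
      entry N x∈N γ = +-mem N (∈-*ʳ N (∈-*ʳ N x∈N v₁) _) (∈-*ʳ N (∈-*ʳ N x∈N v₂) _)

    annihilates⇒𝓚 : ∀ {x} → (∀ v → (x * proj₁ v , x * proj₂ v) ∈ M) → x ∈ 𝓚 D
    annihilates⇒𝓚 {x} x𝒪²⊆M = ⇒∈∏^ k λ i →
      let v , αβv = onto (λ _ → 0#) (λ _ → 1#) in scalar-∈ i x v (x𝒪²⊆M v) (proj₂ (αβv i))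

    -- As `l ≤ k`, both functionals vanish on `M` modulo `𝓜 i ^ l i`, and surjectivity makes the
    -- pair of them invertible there.
    ∈M⇒∈𝓛 : ∀ {v} → v ∈ M → proj₁ v ∈ 𝓛 D × proj₂ v ∈ 𝓛 D
    ∈M⇒∈𝓛 {v} v∈M = ⇒∈∏^ l (proj₁ ∘ v∈^) , ⇒∈∏^ l (proj₂ ∘ v∈^)
      where
      v∈^ : ∀ i → proj₁ v ∈ 𝓜 i ^ l i × proj₂ v ∈ 𝓜 i ^ l i
      v∈^ i =
        let w  , αβw  = onto (λ _ → 1#) (λ _ → 0#)
            w′ , αβw′ = onto (λ _ → 0#) (λ _ → 1#)
            N = 𝓜 i ^ l i
            k⊆l : (𝓜 i ^ k i) ⊆ (𝓜 i ^ l i)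
            k⊆l = ^-antitone (𝓜 i) (l≤k i)
        in invertible-kernel N (α i) (β i) w w′
             (proj₁ (αβw i)) (∈-cancel-+ N (k⊆l (proj₂ (αβw i))) (0-mem N))
             (∈-cancel-+ N (proj₁ (αβw′ i)) (0-mem N)) (k⊆l (proj₂ (αβw′ i)))
             v (proj₁ (∈M⇒ v∈M i)) (k⊆l (proj₂ (∈M⇒ v∈M i)))

    adapted-β : ∀ p → IsAdapted D p → ∀ i → ⟪ β i ∣ coordinates p ⟫ ∈ 𝓜 i ^ (k i ℕ.∸ l i)
    adapted-β p (t , t∈𝓛 , t∉ , tp∈M) i = V.exact-cancel i (l i) (k i) (∈∏^⇒ l t∈𝓛 i)
      (λ t∈^ → t∉ i (𝓛∩^suc⊆𝓛·𝓜 i t∈𝓛 t∈^))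
      (resp (𝓜 i ^ k i)
        (solve 5 (λ t a b β₁ β₂ → t :* a :* β₁ :+ t :* b :* β₂ := t :* (a :* β₁ :+ b :* β₂))
           refl t (fst p) (snd p) (proj₁ (β i)) (proj₂ (β i)))
        (proj₂ (∈M⇒ tp∈M i)))

    -- M = 𝓛 p + 𝓚 𝒪² for every adapted pair p.
    ∈M⇒det∈𝓚 : ∀ p → IsAdapted D p → ∀ {v} → v ∈ M → det v (coordinates p) ∈ 𝓚 D
    ∈M⇒det∈𝓚 p p-adapted {v} v∈M = ⇒∈∏^ k λ i →
      let w , αβw = onto (λ _ → 0#) (λ _ → 1#)
          v₁∈ , v₂∈ = ∈M⇒∈𝓛 v∈M
          K = 𝓜 i ^ k i
          L = 𝓜 i ^ l i
      in resp K (plücker _ _ _ _ _ _ _ _) (∈-neg K (+-mem K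
           (+-mem K (*ₗ-mem K _ (proj₂ (αβw i))) (*ₗ-mem K _ (proj₂ (∈M⇒ v∈M i))))
           -- The entries of `v` give `det w v` order at least `l i`, and `β(p)` contributes the
           -- remaining `k i ∸ l i`.
           (≡.subst (λ n → det w v * ⟪ β i ∣ coordinates p ⟫ ∈ 𝓜 i ^ n) (ℕ.m+[n∸m]≡n (l≤k i))
             (∈-^-+ (𝓜 i) (l i) (k i ℕ.∸ l i)
               (∈-sub L (*ₗ-mem L _ (∈∏^⇒ l v₂∈ i)) (*ₗ-mem L _ (∈∏^⇒ l v₁∈ i)))
               (adapted-β p p-adapted i)))))

    -- The conditions on `α` follow from the entries of `v`. For `β`, modulo `𝓚` the vector is `s p`
    -- with `s ∈ 𝓛`, and `s β(p)` has order at least `l + (k - l)`.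
    det∈𝓚⇒∈M : ∀ p → IsAdapted D p → ∀ {v} → proj₁ v ∈ 𝓛 D → proj₂ v ∈ 𝓛 D →
               det v (coordinates p) ∈ 𝓚 D → v ∈ M
    det∈𝓚⇒∈M p p-adapted {v} v₁∈ v₂∈ det∈ = ⇒∈M λ i →
      let L = 𝓜 i ^ l i
          v₁∈L = ∈∏^⇒ l v₁∈ i
          v₂∈L = ∈∏^⇒ l v₂∈ i
      in +-mem L (∈-*ʳ L v₁∈L _) (∈-*ʳ L v₂∈L _) ,
         functional-∈ (𝓜 i ^ k i) p (β i) v
           (λ x y → ≡.subst (λ n → (x * proj₁ v + y * proj₂ v) * ⟪ β i ∣ coordinates p ⟫ ∈ 𝓜 i ^ n)
             (ℕ.m+[n∸m]≡n (l≤k i))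
             (∈-^-+ (𝓜 i) (l i) (k i ℕ.∸ l i)
               (+-mem L (*ₗ-mem L x v₁∈L) (*ₗ-mem L y v₂∈L)) (adapted-β p p-adapted i)))
           (∈∏^⇒ k det∈ i)

    -- Adaptedness supplies a single `t`; the vanishing of `det (s p) p` extends this to all of `𝓛`.
    𝓛p⊆M : ∀ p → IsAdapted D p → ∀ {s} → s ∈ 𝓛 D → (s * fst p , s * snd p) ∈ M
    𝓛p⊆M p p-adapted {s} s∈ = det∈𝓚⇒∈M p p-adapted (∈-*ʳ (𝓛 D) s∈ _) (∈-*ʳ (𝓛 D) s∈ _)
      (resp (𝓚 D) (solve 3 (λ s a b → con (ℤ.+ 0) := s :* a :* b :- s :* b :* a) refl s (fst p) (snd p))
        (0-mem (𝓚 D)))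

  -- Two submodules: comparison of invariants.

  module _ {M₁ M₂ : Submodule 𝒪² (c ⊔ ℓ)} (M₁-cotorsion : IsCoTorsion M₁) (M₂-cotorsion : IsCoTorsion M₂)
           (D₁ : InvariantDecomposition M₁) (D₂ : InvariantDecomposition M₂) where

    -- The inclusion between the `𝓛` is reversed because `𝓘` is the colon ideal of `𝓚` by `𝓛`.
    𝓘-mono : 𝓛 D₂ ⊆ 𝓛 D₁ → 𝓚 D₁ ⊆ 𝓚 D₂ → 𝓘 D₁ ⊆ 𝓘 D₂
    𝓘-mono 𝓛⊆ 𝓚⊆ x∈ = 𝓚∶𝓛⊆𝓘 M₂-cotorsion D₂ λ s∈ → 𝓚⊆ (𝓛*𝓘⊆𝓚 M₁-cotorsion D₁ (𝓛⊆ s∈) x∈)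

    𝓚-mono : M₁ ⊆ M₂ → 𝓚 D₁ ⊆ 𝓚 D₂
    𝓚-mono M⊆ x∈ = annihilates⇒𝓚 M₂-cotorsion D₂ λ v → M⊆ (𝓚⇒annihilates M₁-cotorsion D₁ x∈ v)

    -- The entries of `s p` lie in the second `𝓛`, and a Bezout relation for `p` recombines them to
    -- `s`.
    𝓛-mono : ∀ p → IsAdapted D₁ p → M₁ ⊆ M₂ → 𝓛 D₁ ⊆ 𝓛 D₂
    𝓛-mono p p-adapted M⊆ {s} s∈ =
      let x , y , xa+yb≈1 = bezout p
          sa∈ , sb∈ = ∈M⇒∈𝓛 M₂-cotorsion D₂ (M⊆ (𝓛p⊆M M₁-cotorsion D₁ p p-adapted s∈))
      in resp (𝓛 D₂)
           (trans (solve 5 (λ s x y a b → x :* (s :* a) :+ y :* (s :* b) := s :* (x :* a :+ y :* b))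
                     refl s x y (fst p) (snd p))
                  (trans (*-congˡ xa+yb≈1) (*-identityʳ s)))
           (+-mem (𝓛 D₂) (*ₗ-mem (𝓛 D₂) x sa∈) (*ₗ-mem (𝓛 D₂) y sb∈))

    adapted-related : ∀ p q → IsAdapted D₁ p → IsAdapted D₂ q → M₁ ⊆ M₂ → 𝓛 D₂ ⊆ 𝓛 D₁ →
                      Setoid._≈_ (PF¹ (𝓘 D₂)) p q
    adapted-related p q p-adapted q-adapted M⊆ 𝓛⊆ = 𝓚∶𝓛⊆𝓘 M₂-cotorsion D₂ λ {s} s∈ →
      resp (𝓚 D₂)
        (solve 5 (λ s a b a′ b′ → s :* a :* b′ :- s :* b :* a′ := s :* (a :* b′ :- b :* a′))
           refl s (fst p) (snd p) (fst q) (snd q))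
        (∈M⇒det∈𝓚 M₂-cotorsion D₂ q q-adapted (M⊆ (𝓛p⊆M M₁-cotorsion D₁ p p-adapted (𝓛⊆ s∈))))

    -- Apply the functional `det _ q` to `v`, which is `s p` modulo `det v p` with `s ∈ 𝓛`: what
    -- remains is `s det p q`, an element of `𝓛 𝓘`.
    related⇒⊆ : ∀ p q → IsAdapted D₁ p → IsAdapted D₂ q →
                𝓛 D₁ ⊆ 𝓛 D₂ → 𝓚 D₁ ⊆ 𝓚 D₂ →
                Setoid._≈_ (PF¹ (𝓘 D₂)) p q → M₁ ⊆ M₂
    related⇒⊆ p q p-adapted q-adapted 𝓛⊆ 𝓚⊆ p∼q {v} v∈M₁ =
      det∈𝓚⇒∈M M₂-cotorsion D₂ q q-adapted v₁∈ v₂∈ (resp (𝓚 D₂) (det-as-functional v)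
        (functional-∈ (𝓚 D₂) p (snd q , - fst q) v
          (λ x y → resp (𝓚 D₂) (*-congˡ (sym (det-as-functional (coordinates p))))
            (𝓛*𝓘⊆𝓚 M₂-cotorsion D₂ (+-mem (𝓛 D₂) (*ₗ-mem (𝓛 D₂) x v₁∈) (*ₗ-mem (𝓛 D₂) y v₂∈)) p∼q))
          (𝓚⊆ (∈M⇒det∈𝓚 M₁-cotorsion D₁ p p-adapted v∈M₁))))
      where
      v₁∈ : proj₁ v ∈ 𝓛 D₂
      v₁∈ = 𝓛⊆ (proj₁ (∈M⇒∈𝓛 M₁-cotorsion D₁ v∈M₁))

      v₂∈ : proj₂ v ∈ 𝓛 D₂
      v₂∈ = 𝓛⊆ (proj₂ (∈M⇒∈𝓛 M₁-cotorsion D₁ v∈M₁))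

      det-as-functional : ∀ w → ⟪ (snd q , - fst q) ∣ w ⟫ ≈ det w (coordinates q)
      det-as-functional (w₁ , w₂) = solve 4 (λ w₁ w₂ a b → w₁ :* b :+ w₂ :* (:- a)
                                                             := w₁ :* b :- w₂ :* a)
        refl w₁ w₂ (fst q) (snd q)

  determined : ∀ {M₁ M₂ : Submodule 𝒪² (c ⊔ ℓ)} → IsCoTorsion M₁ → IsCoTorsion M₂ →
    (D₁ : InvariantDecomposition M₁) (D₂ : InvariantDecomposition M₂) → ∀ p₁ p₂ →
    IsProjectiveInvariant D₁ p₁ → IsProjectiveInvariant D₂ p₂ →
    (𝓛 D₁ ≐ 𝓛 D₂ → 𝓚 D₁ ≐ 𝓚 D₂ → 𝓘 D₁ ≐ 𝓘 D₂)
    × (M₁ ≐ M₂ ⇔ (𝓛 D₁ ≐ 𝓛 D₂ × 𝓚 D₁ ≐ 𝓚 D₂ × Setoid._≈_ (PF¹ (𝓘 D₁)) p₁ p₂))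
  determined {M₁} {M₂} ct₁ ct₂ D₁ D₂ p₁ p₂ (q₁ , q₁-adapted , p₁∼q₁) (q₂ , q₂-adapted , p₂∼q₂) =
    𝓘-equal , mk⇔ forward backward
    where
    module PF¹₁ = Setoid (PF¹ (𝓘 D₁))
    module PF¹₂ = Setoid (PF¹ (𝓘 D₂))

    𝓘-equal : 𝓛 D₁ ≐ 𝓛 D₂ → 𝓚 D₁ ≐ 𝓚 D₂ → 𝓘 D₁ ≐ 𝓘 D₂
    𝓘-equal 𝓛≐ 𝓚≐ = 𝓘-mono ct₁ ct₂ D₁ D₂ (proj₂ 𝓛≐) (proj₁ 𝓚≐) ,
                    𝓘-mono ct₂ ct₁ D₂ D₁ (proj₁ 𝓛≐) (proj₂ 𝓚≐)

    forward : M₁ ≐ M₂ → 𝓛 D₁ ≐ 𝓛 D₂ × 𝓚 D₁ ≐ 𝓚 D₂ × p₁ PF¹₁.≈ p₂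
    forward M≐ = 𝓛≐ , 𝓚≐ ,
      PF¹₁.trans {p₁} {q₁} {p₂} p₁∼q₁ (PF¹₁.trans {q₁} {q₂} {p₂} q₁∼q₂ (PF¹₁.sym {p₂} {q₂} p₂∼q₂′))
      where
      𝓛≐ : 𝓛 D₁ ≐ 𝓛 D₂
      𝓛≐ = 𝓛-mono ct₁ ct₂ D₁ D₂ q₁ q₁-adapted (proj₁ M≐) ,
           𝓛-mono ct₂ ct₁ D₂ D₁ q₂ q₂-adapted (proj₂ M≐)

      𝓚≐ : 𝓚 D₁ ≐ 𝓚 D₂
      𝓚≐ = 𝓚-mono ct₁ ct₂ D₁ D₂ (proj₁ M≐) , 𝓚-mono ct₂ ct₁ D₂ D₁ (proj₂ M≐)

      p₂∼q₂′ : p₂ PF¹₁.≈ q₂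
      -- The hypothesis is a relation modulo the second `𝓘`, so it is transported before the chain
      -- is composed.
      p₂∼q₂′ = proj₂ (𝓘-equal 𝓛≐ 𝓚≐) p₂∼q₂

      q₁∼q₂ : q₁ PF¹₁.≈ q₂
      -- `adapted-related` relates modulo the `𝓘` of its second submodule, hence the exchanged roles
      -- followed by symmetry.
      q₁∼q₂ = PF¹₁.sym {q₂} {q₁}
        (adapted-related ct₂ ct₁ D₂ D₁ q₂ q₁ q₂-adapted q₁-adapted (proj₂ M≐) (proj₁ 𝓛≐))

    backward : 𝓛 D₁ ≐ 𝓛 D₂ × 𝓚 D₁ ≐ 𝓚 D₂ × p₁ PF¹₁.≈ p₂ → M₁ ≐ M₂
    backward (𝓛≐ , 𝓚≐ , p₁∼p₂) =
      related⇒⊆ ct₁ ct₂ D₁ D₂ q₁ q₂ q₁-adapted q₂-adapted (proj₁ 𝓛≐) (proj₁ 𝓚≐) (proj₁ 𝓘≐ q₁∼q₂) ,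
      related⇒⊆ ct₂ ct₁ D₂ D₁ q₂ q₁ q₂-adapted q₁-adapted (proj₂ 𝓛≐) (proj₂ 𝓚≐) (PF¹₁.sym {q₁} {q₂} q₁∼q₂)
      where
      𝓘≐ : 𝓘 D₁ ≐ 𝓘 D₂
      𝓘≐ = 𝓘-equal 𝓛≐ 𝓚≐

      q₁∼q₂ : q₁ PF¹₁.≈ q₂
      q₁∼q₂ = PF¹₁.trans {q₁} {p₁} {q₂} (PF¹₁.sym {p₁} {q₁} p₁∼q₁)
        (PF¹₁.trans {p₁} {p₂} {q₂} p₁∼p₂ (proj₂ 𝓘≐ p₂∼q₂))

open import Level using (suc)

mainTheorem1 : ∀ {c ℓ : Level} → ExcludedMiddle (suc (c ⊔ ℓ)) →
    (𝒪 : CommutativeRing c ℓ) → let open Theory 𝒪 in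
    IsDedekindDomain →
    (M₁ M₂ : Submodule 𝒪² (c ⊔ ℓ)) →
    Proper M₁ → IsCoTorsion M₁ →
    Proper M₂ → IsCoTorsion M₂ →
    (D₁ : InvariantDecomposition M₁) (D₂ : InvariantDecomposition M₂) →
    (a₁b₁ a₂b₂ : UnimodularPair) →
    IsProjectiveInvariant D₁ a₁b₁ → IsProjectiveInvariant D₂ a₂b₂ →
    (𝓛 D₁ ≐ 𝓛 D₂ → 𝓚 D₁ ≐ 𝓚 D₂ → 𝓘 D₁ ≐ 𝓘 D₂)
    × (M₁ ≐ M₂ ⇔ (𝓛 D₁ ≐ 𝓛 D₂ × 𝓚 D₁ ≐ 𝓚 D₂ × Setoid._≈_ (PF¹ (𝓘 D₁)) a₁b₁ a₂b₂))
mainTheorem1 em 𝒪 dedekind M₁ M₂ _ M₁-cotorsion _ M₂-cotorsion D₁ D₂ p₁ p₂ =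
  Invariants.determined em 𝒪 dedekind M₁-cotorsion M₂-cotorsion D₁ D₂ p₁ p₂
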